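{- Let $m\ge 0$ be an integer and let $\lambda,\delta,\rho$ be three proper $m$-marked cycle shapes. For natural numbers $n\geq m$ with $n\geq |\lambda|,|\delta|,|\rho|$, consider the structure coefficient $c_{\underline{\lambda}_n,\underline{\delta}_n}^{\underline{\rho}_n}(n)$ of the $m$-centraliser algebra $Z_{n,m}$, which is a polynomial in $n$. Its degree satisfies $$\deg\left(c_{\underline{\lambda}_n,\underline{\delta}_n}^{\underline{\rho}_n}(n)\right)\leq \frac{|\lambda|+|\delta|-|\rho|}{2}.$$
   Context: Notation: $[n]=\{1,\dots,n\}$, $[0]=\emptyset$; $\mathcal{S}_n$ is the group of permutations of $[n]$, with product given by composition. For $0\le m\le n$, $Stab_n(m)$ is the subgroup of $\mathcal{S}_n$ of permutations fixing every element of $[m]$. Marked cycle shapes: let $\ast$ be a formal symbol. An $m$-marked cycle shape is a finite collection (multiset) of cycles (nonempty words up to cyclic rotation) with entries in $[m]\cup\{\ast\}$ such that each element of $[m]$ appears exactly once in total and $\ast$ appears $r$ times in total for some integer $r\ge 0$. Its size is $|\rho|=m+r$, and $m_1(\rho)$ is the number of cycles of $\rho$ equal to $(\ast)$ (cycles $(a)$ with $a\in[m]$ are not counted). $\rho$ is proper if $m_1(\rho)=0$. $\mathcal{P}^m_n$ is the set of $m$-marked cycle shapes of size $n$. For $n\ge|\rho|$, $\underline{\rho}_n\in\mathcal{P}^m_n$ is the shape obtained from $\rho$ by adding $n-|\rho|$ cycles $(\ast)$. The $m$-marked cycle type of a permutation of $[n]$ is the shape in $\mathcal{P}^m_n$ obtained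 from its full cycle notation (fixed points included) by replacing each element of $[n]\setminus[m]$ by $\ast$. The $m$-centraliser algebra: $Z_{n,m}=\{z\in\mathbb{Z}[\mathcal{S}_n]: \tau z=z\tau \text{ for all }\tau\in Stab_n(m)\}$. For $\lambda\in\mathcal{P}^m_n$, let $K_\lambda$ be the sum of all permutations of $[n]$ with $m$-marked cycle type $\lambda$. The $K_\lambda$, $\lambda\in\mathcal{P}^m_n$, form a $\mathbb{Z}$-basis of $Z_{n,m}$, and the structure coefficients $c_{\lambda,\delta}^{\rho}(n)$ (for $\lambda,\delta,\rho\in\mathcal{P}^m_n$) are defined by $K_\lambda K_\delta=\sum_{\rho\in\mathcal{P}^m_n}c_{\lambda,\delta}^\rho(n)K_\rho$. Degree: for fixed proper $\lambda,\delta,\rho$, there is a unique polynomial $p\in\mathbb{Q}[x]$ such that $c_{\underline{\lambda}_n,\underline{\delta}_n}^{\underline{\rho}_n}(n)=p(n)$ for all integers $n\ge\max(|\lambda|,|\delta|,|\rho|)$; $\deg(c_{\underline{\lambda}_n,\underline{\delta}_n}^{\underline{\rho}_n}(n))$ means $\deg p$, with the convention that the zero polynomial has degree $-\infty$. -}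

module Defs where

open import Level using (0ℓ)
open import Function.Base using (_∘_; _on_)
open import Data.Bool.Base using (if_then_else_)
open import Data.Product.Base using (Σ; _×_; _,_; proj₁; ∃)
open import Data.Sum.Base using (_⊎_; inj₁; inj₂)
open import Data.Maybe.Base as Maybe using (Maybe; just; nothing)
import Data.Maybe.Properties as Maybe
import Data.Maybe.Relation.Unary.Any as MaybeAny
open import Data.Nat.Base as ℕ using (ℕ; zero; suc; _+_; _∸_; _≤_)
import Data.Nat.Properties as ℕ
open import Data.Fin.Base as Fin using (Fin; toℕ; fromℕ<)
import Data.Fin.Properties as Fin
open import Data.Fin.Permutation as Perm using (Permutation′; _⟨$⟩ʳ_; _∘ₚ_)
open import Data.List.Base as List
  using (List; []; _∷_; _++_; [_]; length; map; filter; foldr; concatMap;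
         replicate; allFin; iterate; takeWhile; take; drop; cartesianProductWith; deduplicate)
import Data.List.Properties as List
open import Data.List.NonEmpty.Base as List⁺ using (List⁺; _∷_; toList; _∷⁺_)
open import Data.List.Relation.Unary.All as All using (all?)
open import Data.List.Relation.Unary.Any as Any using (Any; here; there; any?)
import Data.List.Relation.Unary.Any.Properties as Any
open import Data.List.Relation.Unary.Enumerates.Setoid using (IsEnumeration)
import Data.List.Relation.Unary.Enumerates.Setoid.Properties as Enumerates
open import Data.List.Relation.Unary.Unique.Setoid using (Unique)
import Data.List.Relation.Unary.AllPairs.Core as AllPairs
import Data.List.Relation.Unary.Unique.Setoid.Properties as Unique
import Data.List.Relation.Unary.Unique.Propositional.Properties as Unique≡
import Data.List.Relation.Unary.Unique.DecSetoid.Properties as DecUnique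
import Data.List.Membership.Setoid.Properties as Membership
open import Data.List.Membership.Propositional using (_∈_)
import Data.List.Membership.Propositional.Properties as ∈
import Data.List.Relation.Binary.Permutation.Setoid as Permutation
import Data.List.Relation.Binary.Permutation.Setoid.Properties as Permutationₚ
open import Data.Integer.Base as ℤ using (ℤ; 0ℤ; 1ℤ)
open import Data.Rational.Base as ℚ using (ℚ; 0ℚ)
import Data.Rational.Properties as ℚ
import Algebra.Properties.CommutativeMonoid.Sum ℕ.+-0-commutativeMonoid as Sum
open import Relation.Nullary using (yes; no; does; ¬_; ¬?; contradiction)
open import Relation.Nullary.Decidable using (map′; _×-dec_)
open import Relation.Nullary.Construct.Add.Infimum using (_₋; ⊥₋)
open import Relation.Binary.Core using (Rel)
open import Relation.Binary.Bundles using (Setoid; DecSetoid)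
open import Relation.Binary.Definitions using (Decidable; DecidableEquality)
open import Relation.Binary.PropositionalEquality
  using (_≡_; _≢_; refl; sym; trans; cong; cong₂; subst; setoid; module ≡-Reasoning)

module _ {A : Set} where

  infix 4 _∼_

  -- Equality of cycles: the words are cyclic rotations of one another.
  _∼_ : Rel (List⁺ A) 0ℓ
  c ∼ d = ∃ λ us → ∃ λ vs → toList c ≡ us ++ vs × toList d ≡ vs ++ us

  ∼-refl : ∀ {c} → c ∼ c
  ∼-refl {c} = [] , toList c , refl , sym (List.++-identityʳ _)

  ∼-sym : ∀ {c d} → c ∼ d → d ∼ c
  ∼-sym (us , vs , p , q) = vs , us , q , p

  ++-overlap : ∀ (as bs cs ds : List A) → as ++ bs ≡ cs ++ ds →
               (∃ λ es → cs ≡ as ++ es × bs ≡ es ++ ds) ⊎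
               (∃ λ es → as ≡ cs ++ es × ds ≡ es ++ bs)
  ++-overlap []       bs cs       ds eq = inj₁ (cs , refl , eq)
  ++-overlap (a ∷ as) bs []       ds eq = inj₂ (a ∷ as , refl , sym eq)
  ++-overlap (a ∷ as) bs (c ∷ cs) ds eq
    with List.∷-injectiveˡ eq | ++-overlap as bs cs ds (List.∷-injectiveʳ eq)
  ... | refl | inj₁ (es , p , q) = inj₁ (es , cong (a ∷_) p , q)
  ... | refl | inj₂ (es , p , q) = inj₂ (es , cong (a ∷_) p , q)

  ∼-trans : ∀ {c d e} → c ∼ d → d ∼ e → c ∼ e
  ∼-trans (as , bs , p , q) (cs , ds , r , s)
    with ++-overlap bs as cs ds (trans (sym q) r)
  ... | inj₁ (es , refl , refl) =
        es , ds ++ bs , trans p (List.++-assoc es ds bs)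
           , trans s (sym (List.++-assoc ds bs es))
  ... | inj₂ (es , refl , refl) =
        as ++ cs , es , trans p (sym (List.++-assoc as cs es))
                 , trans s (List.++-assoc es as cs)

  cycleSetoid : Setoid 0ℓ 0ℓ
  cycleSetoid = record
    { Carrier = List⁺ A ; _≈_ = _∼_
    ; isEquivalence = record { refl = ∼-refl ; sym = ∼-sym ; trans = ∼-trans } }

  open Permutation cycleSetoid public using () renaming (_↭_ to _≋_)
  private
    module ≋ where
      open Permutation cycleSetoid public
      open Permutationₚ cycleSetoid public

  module _ (_≟_ : DecidableEquality A) where

    private
      _≟*_ : DecidableEquality (List A)
      _≟*_ = List.≡-dec _≟_

      take-length : ∀ (us vs : List A) → take (length us) (us ++ vs) ≡ us
      take-length []       vs = refl
      take-length (u ∷ us) vs = cong (u ∷_) (take-length us vs)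

      drop-length : ∀ (us vs : List A) → drop (length us) (us ++ vs) ≡ vs
      drop-length []       vs = refl
      drop-length (u ∷ us) vs = drop-length us vs

      length≤ : ∀ (us vs : List A) → length us ℕ.< suc (length (us ++ vs))
      length≤ us vs = ℕ.s≤s (List.length-++-≤ˡ us)

    _∼?_ : Decidable _∼_
    c ∼? d = map′ to from (Fin.any? λ k → toList d ≟* rotate (toList c) k)
      where
      rotate : (xs : List A) → Fin (suc (length xs)) → List A
      rotate xs k = drop (toℕ k) xs ++ take (toℕ k) xs

      to : (∃ λ k → toList d ≡ rotate (toList c) k) → c ∼ d
      to (k , eq) = take (toℕ k) (toList c) , drop (toℕ k) (toList c)
                  , sym (List.take++drop≡id (toℕ k) (toList c)) , eq

      from : c ∼ d → ∃ λ k → toList d ≡ rotate (toList c) k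
      from (us , vs , p , q) = subst (λ xs → ∃ λ k → toList d ≡ rotate xs k) (sym p)
        ( fromℕ< (length≤ us vs)
        , subst (λ k → toList d ≡ drop k (us ++ vs) ++ take k (us ++ vs))
                (sym (Fin.toℕ-fromℕ< (length≤ us vs)))
                (trans q (sym (cong₂ _++_ (drop-length us vs) (take-length us vs)))))

    _≋?_ : Decidable _≋_
    []       ≋? []       = yes ≋.↭-refl
    []       ≋? (d ∷ ds) = no (≋.¬x∷xs↭[] ∘ ≋.↭-sym)
    (c ∷ cs) ≋? ds with any? (c ∼?_) ds
    ... | no  c∉ds = no λ p → c∉ds (≋.∈-resp-↭ p (here ∼-refl))
    ... | yes c∈ds with Membership.∈-∃++ cycleSetoid c∈ds
    ...   | es , fs , d , c∼d , ds≋ = map′ to from (cs ≋? (es ++ fs))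
      where
      ds↭ : ds ≋ c ∷ es ++ fs
      ds↭ = ≋.↭-trans (≋.↭-reflexive-≋ ds≋) (≋.shift (∼-sym c∼d) es fs)

      to : cs ≋ es ++ fs → c ∷ cs ≋ ds
      to p = ≋.↭-trans (≋.↭-prep c p) (≋.↭-sym ds↭)

      from : c ∷ cs ≋ ds → cs ≋ es ++ fs
      from p = ≋.drop-∷ (≋.↭-trans p ds↭)

-- Fin m stands for [m]; the element a of [m] is the number a ∸ 1 in Fin m.
Letter : ℕ → Set
Letter m = Maybe (Fin m)

pattern ∗      = nothing
pattern mark a = just a

_≟ˡ_ : ∀ {m} → DecidableEquality (Letter m)
_≟ˡ_ = Maybe.≡-dec Fin._≟_

_≟ᶜ_ : ∀ {m} → DecidableEquality (List⁺ (Letter m))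
(x ∷ xs) ≟ᶜ (y ∷ ys) = map′ (λ { (refl , refl) → refl }) (λ { refl → refl , refl })
                            (x ≟ˡ y ×-dec List.≡-dec _≟ˡ_ xs ys)

letters : {A : Set} → List (List⁺ A) → List A
letters = concatMap toList

occ : ∀ {m} → Letter m → List (Letter m) → ℕ
occ x = length ∘ filter (x ≟ˡ_)

-- The multiset of cycles is given by a list of words; two lists present the
-- same shape when they are related by _≋_, i.e. agree up to reordering the
-- words and rotating each of them.
record Shape (m : ℕ) : Set where
  field
    cycles : List (List⁺ (Letter m))
    once   : ∀ a → occ (mark a) (letters cycles) ≡ 1
open Shape public

-- Each element of [m] contributes 1 to the size, so only the ∗s are counted.
∣_∣ : ∀ {m} → Shape m → ℕ
∣_∣ {m} ρ = m + occ ∗ (letters (cycles ρ))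

m₁ : ∀ {m} → Shape m → ℕ
m₁ ρ = length (filter (_≟ᶜ (∗ ∷ [])) (cycles ρ))

Proper : ∀ {m} → Shape m → Set
Proper ρ = m₁ ρ ≡ 0

𝒫 : ℕ → ℕ → Set
𝒫 m n = Σ (Shape m) λ ρ → ∣ ρ ∣ ≡ n

infix 4 _≈ˢ_

_≈ˢ_ : ∀ {m n} → Rel (𝒫 m n) 0ℓ
_≈ˢ_ = _≋_ on (cycles ∘ proj₁)

shapeDecSetoid : ℕ → ℕ → DecSetoid 0ℓ 0ℓ
shapeDecSetoid m n = record
  { Carrier = 𝒫 m n
  ; _≈_ = _≈ˢ_
  ; isDecEquivalence = record
    { isEquivalence = record
      { refl  = ≋.↭-refl
      ; sym   = ≋.↭-sym
      ; trans = ≋.↭-trans }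
    ; _≟_ = λ λ′ ρ → _≋?_ _≟ˡ_ (cycles (proj₁ λ′)) (cycles (proj₁ ρ)) } }
  where module ≋ = Permutation cycleSetoid

shapeSetoid : ℕ → ℕ → Setoid 0ℓ 0ℓ
shapeSetoid m n = DecSetoid.setoid (shapeDecSetoid m n)

module _ {m : ℕ} where

  occ-++ : ∀ x (xs ys : List (Letter m)) → occ x (xs ++ ys) ≡ occ x xs + occ x ys
  occ-++ x xs ys = trans (cong length (List.filter-++ (x ≟ˡ_) xs ys))
                         (List.length-++ (filter (x ≟ˡ_) xs))

  letters-pad : ∀ (cs : List (List⁺ (Letter m))) k →
                letters (cs ++ replicate k (∗ ∷ [])) ≡ letters cs ++ replicate k ∗
  letters-pad cs k = trans (List.concatMap-++ toList cs _) (cong (letters cs ++_) (aux k))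
    where
    aux : ∀ k → letters (replicate k (∗ ∷ [])) ≡ replicate k ∗
    aux zero    = refl
    aux (suc k) = cong (∗ ∷_) (aux k)

  occ-mark-∗s : ∀ (a : Fin m) k → occ (mark a) (replicate k ∗) ≡ 0
  occ-mark-∗s a zero    = refl
  occ-mark-∗s a (suc k) = occ-mark-∗s a k

  occ-∗-∗s : ∀ k → occ {m} ∗ (replicate k ∗) ≡ k
  occ-∗-∗s zero    = refl
  occ-∗-∗s (suc k) = cong suc (occ-∗-∗s k)

  -- The shape ρ̲ₙ.
  pad : (ρ : Shape m) (n : ℕ) → ∣ ρ ∣ ≤ n → 𝒫 m n
  pad ρ n ∣ρ∣≤n = record { cycles = cs ; once = once′ } , size
    where
    k  = n ∸ ∣ ρ ∣
    cs = cycles ρ ++ replicate k (∗ ∷ [])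
    occ-cs : ∀ x → occ x (letters cs) ≡ occ x (letters (cycles ρ)) + occ x (replicate k ∗)
    occ-cs x = trans (cong (occ x) (letters-pad (cycles ρ) k)) (occ-++ x (letters (cycles ρ)) _)
    once′ : ∀ a → occ (mark a) (letters cs) ≡ 1
    once′ a = trans (occ-cs (mark a)) (cong₂ _+_ (once ρ a) (occ-mark-∗s a k))
    size : m + occ ∗ (letters cs) ≡ n
    size = trans (cong (m +_) (trans (occ-cs ∗) (cong (occ ∗ (letters (cycles ρ)) +_) (occ-∗-∗s k))))
          (trans (sym (ℕ.+-assoc m _ k)) (ℕ.m+[n∸m]≡n ∣ρ∣≤n))

-- (i  u(i)  u²(i)  …), stopping before the first return to i.
cycleOf : ∀ {n} → Permutation′ n → Fin n → List⁺ (Fin n)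
cycleOf {n} u i =
  i ∷ takeWhile (λ j → ¬? (j Fin.≟ i)) (iterate (u ⟨$⟩ʳ_) (u ⟨$⟩ʳ i) n)

-- Each cycle is written once, starting from its least element.
cycleNotation : ∀ {n} → Permutation′ n → List (List⁺ (Fin n))
cycleNotation {n} u =
  map (cycleOf u) (filter (λ i → all? (i Fin.≤?_) (toList (cycleOf u i))) (allFin n))

-- An element of [n] lies in [m] exactly when its index is less than m.
forget : ∀ m {n} → Fin n → Letter m
forget m i with toℕ i ℕ.<? m
... | yes i<m = mark (fromℕ< i<m)
... | no  _   = ∗

markedCycleType : ∀ m {n} → Permutation′ n → List (List⁺ (Letter m))
markedCycleType m u = map (List⁺.map (forget m)) (cycleNotation u)

permSetoid : ℕ → Setoid 0ℓ 0ℓ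
permSetoid n = record
  { Carrier = Permutation′ n
  ; _≈_ = Perm._≈_
  ; isEquivalence = record
    { refl  = λ _ → refl
    ; sym   = λ p i → sym (p i)
    ; trans = λ p q i → trans (p i) (q i) } }

permutations : ∀ n → List (Permutation′ n)
permutations zero    = [ Perm.id ]
permutations (suc n) =
  cartesianProductWith (Perm.insert Fin.zero) (allFin (suc n)) (permutations n)

private
  insert-cong : ∀ {n} {i j : Fin (suc n)} {u v : Permutation′ n} → i ≡ j → u Perm.≈ v →
                Perm.insert Fin.zero i u Perm.≈ Perm.insert Fin.zero j v
  insert-cong         refl p Fin.zero    = refl
  insert-cong {i = i} refl p (Fin.suc k) = cong (Fin.punchIn i) (p k)

  insert-injective : ∀ {n} {i j : Fin (suc n)} {u v : Permutation′ n} →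
                     Perm.insert Fin.zero i u Perm.≈ Perm.insert Fin.zero j v →
                     i ≡ j × u Perm.≈ v
  insert-injective {i = i} p with p Fin.zero
  ... | refl = refl , λ k → Fin.punchIn-injective i _ _ (p (Fin.suc k))

permutations-enumeration : ∀ n → IsEnumeration (permSetoid n) (permutations n)
permutations-enumeration zero    u = here λ ()
permutations-enumeration (suc n) u =
  Membership.∈-resp-≈ (permSetoid (suc n))
    {x = Perm.insert Fin.zero (u ⟨$⟩ʳ Fin.zero) u′} {y = u} (Perm.insert-remove Fin.zero u)
    (Membership.∈-cartesianProductWith⁺ (setoid _) (permSetoid n) (permSetoid (suc n))
      (λ {i} {j} {u} {v} → insert-cong {i = i} {j} {u} {v})
      {a = u ⟨$⟩ʳ Fin.zero} {b = u′}
      (∈.∈-allFin (u ⟨$⟩ʳ Fin.zero)) (permutations-enumeration n u′))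
  where u′ = Perm.remove Fin.zero u

permutations-unique : ∀ n → Unique (permSetoid n) (permutations n)
permutations-unique zero    = All.[] AllPairs.∷ AllPairs.[]
permutations-unique (suc n) =
  Unique.cartesianProductWith⁺ (setoid _) (permSetoid n) (permSetoid (suc n))
    (Perm.insert Fin.zero) (λ {i} {j} {u} {v} → insert-injective {i = i} {j} {u} {v})
    (Unique≡.allFin⁺ (suc n)) (permutations-unique n)

module _ {A : Set} (alphabet : List A) where

  prepend : A → List (List⁺ A) → List (List (List⁺ A))
  prepend x []       = [ [ x ∷ [] ] ]
  prepend x (c ∷ cs) = ((x ∷ []) ∷ c ∷ cs) ∷ ((x ∷⁺ c) ∷ cs) ∷ []

  -- All lists of nonempty words with a given total number of letters.
  wordLists : ℕ → List (List (List⁺ A))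
  wordLists zero    = [ [] ]
  wordLists (suc n) = concatMap (λ x → concatMap (prepend x) (wordLists n)) alphabet

  wordLists-complete : (∀ x → x ∈ alphabet) → ∀ cs → cs ∈ wordLists (length (letters cs))
  wordLists-complete _∈A = complete
    where
    extend : ∀ x n {cs ds} → ds ∈ wordLists n → cs ∈ prepend x ds → cs ∈ wordLists (suc n)
    extend x n ds∈ cs∈ = ∈.∈-concatMap⁺ _ (Any.map (λ { refl →
                       ∈.∈-concatMap⁺ (prepend x) (Any.map (λ { refl → cs∈ }) ds∈) }) (x ∈A))

    new : ∀ x cs → ((x ∷ []) ∷ cs) ∈ prepend x cs
    new x []       = here refl
    new x (c ∷ cs) = here refl

    complete : ∀ cs → cs ∈ wordLists (length (letters cs))
    word     : ∀ x xs cs → ((x ∷ xs) ∷ cs) ∈ wordLists (suc (length (xs ++ letters cs)))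
    complete []              = here refl
    complete ((x ∷ xs) ∷ cs) = word x xs cs
    word x []       cs = extend x (length (letters cs)) (complete cs) (new x cs)
    word x (y ∷ ys) cs = extend x (suc (length (ys ++ letters cs))) (word y ys cs) (there (here refl))

alphabet : ∀ m → List (Letter m)
alphabet m = ∗ ∷ map mark (allFin m)

toShape : ∀ m n → List (List⁺ (Letter m)) → Maybe (𝒫 m n)
toShape m n cs
  with Fin.all? (λ a → occ (mark a) (letters cs) ℕ.≟ 1) | m + occ ∗ (letters cs) ℕ.≟ n
... | yes once | yes size = just (record { cycles = cs ; once = once } , size)
... | _        | _        = nothing

-- The finite set of shapes of size n: exactly one presentation of each shape.
shapes : ∀ m n → List (𝒫 m n)
shapes m n = deduplicate (DecSetoid._≟_ (shapeDecSetoid m n))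
                         (List.mapMaybe (toShape m n) (wordLists (alphabet m) n))

∈-alphabet : ∀ {m} (x : Letter m) → x ∈ alphabet m
∈-alphabet ∗        = here refl
∈-alphabet (mark a) = there (∈.∈-map⁺ mark (∈.∈-allFin a))

sum-bump : ∀ {m} (b : Fin m) (f g : Fin m → ℕ) → g b ≡ suc (f b) →
           (∀ a → a ≢ b → g a ≡ f a) → Sum.sum g ≡ suc (Sum.sum f)
sum-bump Fin.zero    f g p q =
  cong₂ _+_ p (Sum.sum-cong-≗ λ a → q (Fin.suc a) λ ())
sum-bump (Fin.suc b) f g p q =
  trans (cong₂ _+_ (q Fin.zero λ ())
          (sum-bump b (f ∘ Fin.suc) (g ∘ Fin.suc) p λ a a≢b → q (Fin.suc a) (a≢b ∘ Fin.suc-injective)))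
        (ℕ.+-suc (f Fin.zero) _)

length-occ : ∀ {m} (xs : List (Letter m)) →
             length xs ≡ occ ∗ xs + Sum.sum (λ a → occ (mark a) xs)
length-occ {m} []            = sym (Sum.sum-replicate-zero m)
length-occ     (∗ ∷ xs)      = cong suc (length-occ xs)
length-occ {m} (mark b ∷ xs) = begin
  suc (length xs)
    ≡⟨ cong suc (length-occ xs) ⟩
  suc (occ ∗ xs + Sum.sum (λ a → occ (mark a) xs))
    ≡⟨ ℕ.+-suc (occ ∗ xs) _ ⟨
  occ ∗ xs + suc (Sum.sum (λ a → occ (mark a) xs))
    ≡⟨ cong (occ ∗ xs +_) (sym (sum-bump b _ _ here≡ there≡)) ⟩
  occ ∗ xs + Sum.sum (λ a → occ (mark a) (mark b ∷ xs)) ∎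
  where
  open ≡-Reasoning

  here≡ : occ (mark b) (mark b ∷ xs) ≡ suc (occ (mark b) xs)
  here≡ = cong length (List.filter-accept (mark b ≟ˡ_) refl)

  there≡ : ∀ a → a ≢ b → occ (mark a) (mark b ∷ xs) ≡ occ (mark a) xs
  there≡ a a≢b = cong length
    (List.filter-reject (mark a ≟ˡ_) (a≢b ∘ Maybe.just-injective))

length-shape : ∀ {m} (ρ : Shape m) → length (letters (cycles ρ)) ≡ ∣ ρ ∣
length-shape {m} ρ = begin
  length xs                                   ≡⟨ length-occ xs ⟩
  occ ∗ xs + Sum.sum (λ a → occ (mark a) xs)  ≡⟨ cong (occ ∗ xs +_) (Sum.sum-cong-≗ (once ρ)) ⟩
  occ ∗ xs + Sum.sum {m} (λ _ → 1)            ≡⟨ cong (occ ∗ xs +_) (sum-ones m) ⟩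
  occ ∗ xs + m                                ≡⟨ ℕ.+-comm (occ ∗ xs) m ⟩
  m + occ ∗ xs                                ∎
  where
  open ≡-Reasoning
  xs = letters (cycles ρ)
  sum-ones : ∀ m → Sum.sum {m} (λ _ → 1) ≡ m
  sum-ones zero    = refl
  sum-ones (suc m) = cong suc (sum-ones m)

shapes-enumeration : ∀ m n → IsEnumeration (shapeSetoid m n) (shapes m n)
shapes-enumeration m n = Enumerates.deduplicate⁺ (shapeDecSetoid m n) λ (ρ , size) →
  Any.mapMaybe⁺ (toShape m n) _ (Any.map⁺ (Any.map
    (λ { refl → toShape-complete ρ size })
    (subst (λ k → cycles ρ ∈ wordLists (alphabet m) k) (trans (length-shape ρ) size)
           (wordLists-complete (alphabet m) ∈-alphabet (cycles ρ)))))
  where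
  toShape-complete : (ρ : Shape m) (size : ∣ ρ ∣ ≡ n) →
                     MaybeAny.Any ((ρ , size) ≈ˢ_) (toShape m n (cycles ρ))
  toShape-complete ρ size
    with Fin.all? (λ a → occ (mark a) (letters (cycles ρ)) ℕ.≟ 1)
       | m + occ ∗ (letters (cycles ρ)) ℕ.≟ n
  ... | yes _   | yes _   = MaybeAny.just (Setoid.refl (shapeSetoid m n) {ρ , size})
  ... | yes _   | no ¬sz  = contradiction size ¬sz
  ... | no ¬one | _       = contradiction (once ρ) ¬one

shapes-unique : ∀ m n → Unique (shapeSetoid m n) (shapes m n)
shapes-unique m n = DecUnique.deduplicate-! (shapeDecSetoid m n) _

-- z represents the sum over u of z(u) u.  Permutations are compared pointwise, so
-- z is meant to respect Perm._≈_, as K ρ does and as _⋆_ preserves.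
ℤ[𝒮_] : ℕ → Set
ℤ[𝒮 n ] = Permutation′ n → ℤ

∑ : {A : Set} → List A → (A → ℤ) → ℤ
∑ xs f = foldr ℤ._+_ 0ℤ (map f xs)

infixr 8 _·_

-- (u · v)(i) = u(v(i)), whereas _∘ₚ_ composes in diagrammatic order.
_·_ : ∀ {n} → Permutation′ n → Permutation′ n → Permutation′ n
u · v = v ∘ₚ u

infixl 7 _⋆_

_⋆_ : ∀ {n} → ℤ[𝒮 n ] → ℤ[𝒮 n ] → ℤ[𝒮 n ]
_⋆_ {n} y z w = ∑ (permutations n) λ u → y u ℤ.* z (Perm.flip u · w)

-- The sum of the permutations of type ρ, i.e. the indicator function of these.
K : ∀ {m n} → 𝒫 m n → ℤ[𝒮 n ]
K {m} (ρ , _) w = if does (_≋?_ _≟ˡ_ (markedCycleType m w) (cycles ρ)) then 1ℤ else 0ℤ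

-- The K ρ form a ℤ-basis of the m-centraliser algebra, a subring of ℤ[𝒮 n ], so
-- the products K κ ⋆ K δ are expanded in ℤ[𝒮 n ].  Since a shape has several
-- presentations, coeff must respect _≈ˢ_; together the fields determine it.
record StructureCoefficients (m n : ℕ) : Set where
  field
    coeff      : 𝒫 m n → 𝒫 m n → 𝒫 m n → ℤ
    coeff-cong : ∀ {κ κ′ δ δ′ ρ ρ′} → κ ≈ˢ κ′ → δ ≈ˢ δ′ → ρ ≈ˢ ρ′ →
                 coeff κ δ ρ ≡ coeff κ′ δ′ ρ′
    expansion  : ∀ κ δ w →
                 (K κ ⋆ K δ) w ≡ ∑ (shapes m n) λ ρ → coeff κ δ ρ ℤ.* K ρ w
open StructureCoefficients public

-- Coefficients in increasing degree; trailing zeros are allowed.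
Polynomial : Set
Polynomial = List ℚ

eval : Polynomial → ℚ → ℚ
eval p x = foldr (λ a y → a ℚ.+ x ℚ.* y) 0ℚ p

-- The degree of the zero polynomial is −∞, written ⊥₋.
deg : Polynomial → ℕ ₋
deg []      = ⊥₋
deg (a ∷ p) with deg p | a ℚ.≟ 0ℚ
... | just d  | _     = just (suc d)
... | nothing | yes _ = ⊥₋
... | nothing | no  _ = just 0

fromℕ : ℕ → ℚ
fromℕ n = ℤ.+ n ℚ./ 1

{-# OPTIONS --safe #-}

-- If w has type ρ̲ₙ, the coefficient is the number of u of type κ̲ₙ such that
-- u⁻¹w has type δ̲ₙ.  Take for w a permutation of [|ρ|] extended by fixed points.
-- A point beyond |ρ| that is fixed by u is fixed by u⁻¹w, and deleting it leads
-- to the same count with n − 1 in place of n.  So the numbers F(n, b) of those u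
-- that move all points from b onwards satisfy Pascal's recurrence
-- F(n + 1, b + 1) = F(n, b) + F(n + 1, b).  The e = n − b points from b onwards
-- are moved by u and by u⁻¹w but not by w, so comparing numbers of fixed points
-- shows that F(n, b) = 0 unless |ρ| + 2e ≤ |κ| + |δ|.  Newton's formula then
-- expresses F(n, n) through the binomial coefficients of n − |ρ| over these e.
module Submission where

open import Defs
open import Level using (0ℓ)
open import Function.Base using (_∘_; const)
open import Function.Bundles using (Injection)
open import Function.Properties.Inverse using (↔⇒↣)
open import Data.Bool.Base using (if_then_else_)
open import Data.Product.Base using (∃; _×_; _,_; proj₁; proj₂)
open import Data.Sum.Base as Sum using (_⊎_; inj₁; inj₂)
open import Data.Maybe.Base as Maybe using (just; nothing)
open import Data.Nat.Base as ℕ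
  using (ℕ; zero; suc; _≤_; _<_; _≤′_; ≤′-refl; ≤′-step; z≤n; s≤s; z<s; s<s;
         ⌈_/2⌉)
import Data.Nat.Properties as ℕ
open import Data.Nat.Combinatorics using (_C_; nC1≡n; nCk+nC[k+1]≡[n+1]C[k+1]; k>n⇒nCk≡0)
open import Data.Nat.Solver using () renaming (module +-*-Solver to ℕSolver)
open import Data.Integer.Base as ℤ using (ℤ; 0ℤ; 1ℤ)
import Data.Integer.Properties as ℤ
open import Data.Integer.Solver using () renaming (module +-*-Solver to ℤSolver)
open import Data.Rational.Base as ℚ using (ℚ; 0ℚ; 1ℚ; _/_)
import Data.Rational.Properties as ℚ
open import Data.Rational.Solver using () renaming (module +-*-Solver to ℚSolver)
open import Data.Rational.Unnormalised.Base as ℚᵘ using (mkℚᵘ; *≡*; *≤*)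
import Data.Rational.Unnormalised.Properties as ℚᵘ
open import Data.Fin.Base as Fin using (Fin; punchIn; toℕ)
import Data.Fin.Properties as Fin
open import Data.Fin.Permutation as Perm using (Permutation′; _⟨$⟩ʳ_; _⟨$⟩ˡ_)
open import Data.List.Base
  using (List; []; _∷_; _++_; length; map; filter; allFin; iterate; takeWhile;
         replicate; tabulate)
open import Data.List.Properties as List using (∷-injectiveˡ; ∷-injectiveʳ; length-map; length-tabulate; filter-none)
open import Data.List.NonEmpty.Base as List⁺ using (List⁺; _∷_; toList)
open import Data.List.Relation.Unary.All as All using (All; []; _∷_; all?)
import Data.List.Relation.Unary.All.Properties as All
open import Data.List.Relation.Unary.Any using (here; there; any?)
open import Data.List.Relation.Unary.AllPairs using ([]; _∷_)
open import Data.List.Membership.Propositional using (_∈_; _∉_; find; lose)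
import Data.List.Membership.Propositional.Properties as ∈
import Data.List.Membership.Setoid as Membership
import Data.List.Membership.Setoid.Properties as Membershipₚ
open import Data.List.Relation.Unary.Unique.Propositional using (Unique)
import Data.List.Relation.Unary.Unique.Propositional.Properties as Unique≡
import Data.List.Relation.Unary.Unique.Setoid as UniqueS
import Data.List.Relation.Unary.Unique.Setoid.Properties as Uniqueₚ
import Data.List.Relation.Binary.Permutation.Setoid as Permutation
import Data.List.Relation.Binary.Permutation.Setoid.Properties as Permutationₚ
open import Relation.Nullary using (Dec; yes; no; ¬_; ¬?; contradiction; does)
open import Relation.Nullary.Decidable using (_×-dec_; _→-dec_)
open import Relation.Nullary.Construct.Add.Infimum using ([_])
open import Relation.Unary using (Pred; Decidable)
open import Relation.Binary.Bundles using (Setoid)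
open import Relation.Binary.Construct.Add.Infimum.NonStrict ℚ._≤_ as ≤₋ using (_≤₋_)
open import Relation.Binary.Definitions using (DecidableEquality; _Respects_)
open import Relation.Binary.PropositionalEquality hiding ([_])

-- Properness is what makes fixed points comparable: padding a proper shape κ to size n adds exactly
-- n - |κ| cycles (∗), and these are the fixed points outside [m] of every permutation of that type.
-- If f(u) is the number of such points of u, each single point contributes to f(u) + f(u⁻¹w) + 2e
-- at most what it contributes to f(w) + n, and inserting the three counts leaves |ρ| + 2e ≤ |κ| +
-- |δ|. Moving all points from b onwards is required in order to make the recurrence a difference
-- table: along the line n - b = e, the values for e + 1 are the forward differences of the values
-- for e. The bound makes all differences of high order vanish, so the Newton series is finite, and
-- the degree is bounded by the length of a coefficient list. The coefficient is read off at one
-- permutation of the type of ρ, which has to be constructed from the words of ρ. Permutations carry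
-- their inverses and are compared pointwise, so bijections between sets of permutations are set up
-- modulo that equality.

module _ where

  open import Data.Nat.Base using (_+_; _*_; _∸_)

  -- Counting permutations

  module _ (S : Setoid 0ℓ 0ℓ) where
    open Setoid S using (_≈_) renaming (refl to ≈-refl; sym to ≈-sym; trans to ≈-trans)
    open Membership S using () renaming (_∈_ to _∈ˢ_)
    open Permutation S using (_↭_; ↭-refl; ↭-sym; ↭-trans; ↭-prep; ↭-reflexive-≋)
    open Permutationₚ S using (shift; ∈-resp-↭; Unique-resp-↭)

    -- The head of `xs` is removed from both lists; by uniqueness no second copy of it remains in
    -- either, so the rests still have the same elements. Bijections are turned into equal counts or
    -- reorderings in this way.
    unique⇒↭ : ∀ {xs ys} → UniqueS.Unique S xs → UniqueS.Unique S ys →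
               (∀ {x} → x ∈ˢ xs → x ∈ˢ ys) → (∀ {x} → x ∈ˢ ys → x ∈ˢ xs) → xs ↭ ys
    unique⇒↭ {[]}     {[]}     _ _ _ _  = ↭-refl
    unique⇒↭ {[]}     {y ∷ ys} _ _ _ ys⊆ = contradiction (ys⊆ (here ≈-refl)) λ ()
    unique⇒↭ {x ∷ xs} {ys} (x∉xs ∷ xs!) ys! xs⊆ ys⊆
      with es , fs , d , x≈d , ys≋ ← Membershipₚ.∈-∃++ S (xs⊆ (here ≈-refl)) =
      ↭-trans (↭-prep x (unique⇒↭ xs! rest! to from)) (↭-sym ys↭)
      where
      ys↭ : ys ↭ x ∷ es ++ fs
      ys↭ = ↭-trans (↭-reflexive-≋ ys≋) (shift (≈-sym x≈d) es fs)

      x∷rest! : UniqueS.Unique S (x ∷ es ++ fs)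
      x∷rest! = Unique-resp-↭ ys↭ ys!

      rest! : UniqueS.Unique S (es ++ fs)
      rest! with x∷rest!
      ... | _ ∷ u = u

      to : ∀ {z} → z ∈ˢ xs → z ∈ˢ es ++ fs
      to z∈ with ∈-resp-↭ ys↭ (xs⊆ (there z∈))
      ... | there z∈′ = z∈′
      ... | here z≈x  = contradiction (Membershipₚ.∈-resp-≈ S z≈x z∈) (All.All¬⇒¬Any x∉xs)

      from : ∀ {z} → z ∈ˢ es ++ fs → z ∈ˢ xs
      from z∈ with ys⊆ (∈-resp-↭ (↭-sym ys↭) (there z∈))
      ... | there z∈′ = z∈′
      ... | here z≈x with x∷rest!
      ...   | x∉ ∷ _ = contradiction (Membershipₚ.∈-resp-≈ S z≈x z∈) (All.All¬⇒¬Any x∉)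

  module _ {A : Set} {P Q : Pred A 0ℓ} (P? : Decidable P) (Q? : Decidable Q) where

    length-filter-split : ∀ xs → length (filter P? xs) ≡
      length (filter (λ x → Q? x ×-dec P? x) xs) +
      length (filter (λ x → ¬? (Q? x) ×-dec P? x) xs)
    length-filter-split []       = refl
    length-filter-split (x ∷ xs) with P? x | Q? x
    ... | yes _ | yes _ = cong suc (length-filter-split xs)
    ... | yes _ | no  _ = trans (cong suc (length-filter-split xs)) (sym (ℕ.+-suc _ _))
    ... | no  _ | yes _ = length-filter-split xs
    ... | no  _ | no  _ = length-filter-split xs

  count : ∀ {n} {P : Pred (Permutation′ n) 0ℓ} → Decidable P → ℕ
  count {n} P? = length (filter P? (permutations n))

  count-cong : ∀ {n} {P Q : Pred (Permutation′ n) 0ℓ} (P? : Decidable P) (Q? : Decidable Q) →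
               (∀ u → P u → Q u) → (∀ u → Q u → P u) → count P? ≡ count Q?
  count-cong P? Q? to from =
    cong length (List.filter-≐ P? Q? ((λ {u} → to u) , (λ {u} → from u)) (permutations _))

  count-none : ∀ {n} {P : Pred (Permutation′ n) 0ℓ} (P? : Decidable P) →
               (∀ u → ¬ P u) → count P? ≡ 0
  count-none P? ¬P = cong length (filter-none P? (All.universal ¬P (permutations _)))

  count-split : ∀ {n} {P Q : Pred (Permutation′ n) 0ℓ} (P? : Decidable P) (Q? : Decidable Q) →
                count P? ≡ count (λ u → Q? u ×-dec P? u) + count (λ u → ¬? (Q? u) ×-dec P? u)
  count-split {n} P? Q? = length-filter-split P? Q? (permutations n)

  -- Inverse to the deletion of a fixed point `j`. The other points are renumbered by `punchIn j`,
  -- so those from `j` onwards move up by one; this is the shift of b in the recurrence.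
  fixAt : ∀ {n} → Fin (suc n) → Permutation′ n → Permutation′ (suc n)
  fixAt j = Perm.insert j j

  fixAt-fixes : ∀ {n} j (u : Permutation′ n) → fixAt j u ⟨$⟩ʳ j ≡ j
  fixAt-fixes j u with j Fin.≟ j
  ... | yes _  = refl
  ... | no j≢j = contradiction refl j≢j

  fixAt-remove : ∀ {n} (j : Fin (suc n)) u → u ⟨$⟩ʳ j ≡ j → fixAt j (Perm.remove j u) Perm.≈ u
  fixAt-remove j u uj≡j = subst (λ l → Perm.insert j l (Perm.remove j u) Perm.≈ u) uj≡j
                                (Perm.insert-remove j u)

  punchIn-cases : ∀ {n} (j : Fin (suc n)) {P : Pred (Fin (suc n)) 0ℓ} →
                  P j → (∀ i → P (punchIn j i)) → ∀ i → P i
  punchIn-cases j {P} pj p i with j Fin.≟ i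
  ... | yes refl = pj
  ... | no  j≢i  = subst P (Fin.punchIn-punchOut j≢i) (p (Fin.punchOut j≢i))

  fixAt-cong : ∀ {n} j {u v : Permutation′ n} → u Perm.≈ v → fixAt j u Perm.≈ fixAt j v
  fixAt-cong j {u} {v} u≈v = punchIn-cases j
    (trans (fixAt-fixes j u) (sym (fixAt-fixes j v)))
    λ i → trans (Perm.insert-punchIn j j u i)
                (trans (cong (punchIn j) (u≈v i)) (sym (Perm.insert-punchIn j j v i)))

  fixAt-injective : ∀ {n} j {u v : Permutation′ n} → fixAt j u Perm.≈ fixAt j v → u Perm.≈ v
  fixAt-injective j {u} {v} eq i = Fin.punchIn-injective j _ _
    (trans (sym (Perm.insert-punchIn j j u i)) (trans (eq (punchIn j i)) (Perm.insert-punchIn j j v i)))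

  -- The permutations fixing j are the fixAt j u, each for exactly one u.
  count-fixing : ∀ {n} (j : Fin (suc n)) {P : Pred (Permutation′ (suc n)) 0ℓ} (P? : Decidable P) →
                 P Respects Perm._≈_ →
                 count (λ u → (u ⟨$⟩ʳ j Fin.≟ j) ×-dec P? u) ≡ count (λ u → P? (fixAt j u))
  count-fixing {n} j {P} P? P-resp = trans
    (Permutationₚ.xs↭ys⇒|xs|≡|ys| S′ (unique⇒↭ S′ fixing! fixAt! (λ {u} → to {u}) (λ {u} → from {u})))
    (length-map (fixAt j) (filter (P? ∘ fixAt j) (permutations n)))
    where
    S = permSetoid n
    S′ = permSetoid (suc n)
    open Membership S′ using () renaming (_∈_ to _∈′_)

    R? : Decidable (λ u → u ⟨$⟩ʳ j ≡ j × P u)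
    R? u = (u ⟨$⟩ʳ j Fin.≟ j) ×-dec P? u

    R-resp : (λ u → u ⟨$⟩ʳ j ≡ j × P u) Respects Perm._≈_
    R-resp {u} {v} u≈v (uj , Pu) = trans (sym (u≈v j)) uj , P-resp {u} {v} u≈v Pu

    Pfix-resp : (P ∘ fixAt j) Respects Perm._≈_
    Pfix-resp {u} {v} u≈v = P-resp {fixAt j u} {fixAt j v} (fixAt-cong j {u} {v} u≈v)

    fixing! : UniqueS.Unique S′ (filter R? (permutations (suc n)))
    fixing! = Uniqueₚ.filter⁺ S′ R? (permutations-unique (suc n))

    fixAt! : UniqueS.Unique S′ (map (fixAt j) (filter (P? ∘ fixAt j) (permutations n)))
    fixAt! = Uniqueₚ.map⁺ S S′ (λ {u} {v} → fixAt-injective j {u} {v})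
               (Uniqueₚ.filter⁺ S (P? ∘ fixAt j) (permutations-unique n))

    to : ∀ {u} → u ∈′ filter R? (permutations (suc n)) →
         u ∈′ map (fixAt j) (filter (P? ∘ fixAt j) (permutations n))
    to {u} u∈ with _ , uj , Pu ← Membershipₚ.∈-filter⁻ S′ R? (λ {u} {v} → R-resp {u} {v})
               {v = u} {xs = permutations (suc n)} u∈ =
      Membershipₚ.∈-resp-≈ S′ {x = fixAt j u′} {y = u} (fixAt-remove j u uj)
        (Membershipₚ.∈-map⁺ S S′ {f = fixAt j} (λ {u} {v} → fixAt-cong j {u} {v}) {v = u′}
          (Membershipₚ.∈-filter⁺ S (P? ∘ fixAt j) (λ {u} {v} → Pfix-resp {u} {v})
             {v = u′} {xs = permutations n} (permutations-enumeration n u′)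
            (P-resp {u} {fixAt j u′} (λ i → sym (fixAt-remove j u uj i)) Pu)))
      where u′ = Perm.remove j u

    from : ∀ {u} → u ∈′ map (fixAt j) (filter (P? ∘ fixAt j) (permutations n)) →
           u ∈′ filter R? (permutations (suc n))
    from {u} u∈ with v , v∈ , u≈ ← Membershipₚ.∈-map⁻ S S′ {v = u} {xs = filter (P? ∘ fixAt j) (permutations n)} u∈
                with _ , Pv ← Membershipₚ.∈-filter⁻ S (P? ∘ fixAt j) (λ {u} {v} → Pfix-resp {u} {v})
                       {v = v} {xs = permutations n} v∈ =
      Membershipₚ.∈-filter⁺ S′ R? (λ {u} {v} → R-resp {u} {v})
          {v = u} {xs = permutations (suc n)} (permutations-enumeration (suc n) u)
        (R-resp {fixAt j v} {u} (λ i → sym (u≈ i)) (fixAt-fixes j v , Pv))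

  -- Cycle types and fixed points

  module _ {A : Set} where

    iterate-cong : ∀ {f g : A → A} → (∀ x → f x ≡ g x) → ∀ x n → iterate f x n ≡ iterate g x n
    iterate-cong         f≗g x zero    = refl
    iterate-cong {g = g} f≗g x (suc n) = cong (x ∷_)
      (trans (cong (λ y → iterate _ y n) (f≗g x)) (iterate-cong f≗g (g x) n))

    power : (A → A) → ℕ → A → A
    power f zero    x = x
    power f (suc k) x = power f k (f x)

    power-+ : ∀ f a b x → power f (a + b) x ≡ power f b (power f a x)
    power-+ f zero    b x = refl
    power-+ f (suc a) b x = power-+ f a b (f x)

    power-injective : ∀ {f} → (∀ {x y} → f x ≡ f y → x ≡ y) →
                      ∀ k {x y} → power f k x ≡ power f k y → x ≡ y
    power-injective inj zero    eq = eq
    power-injective inj (suc k) eq = inj (power-injective inj k eq)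

    power∈iterate : ∀ f {k n} x → k < n → power f k x ∈ iterate f x n
    power∈iterate f {zero}  {suc n} x _         = here refl
    power∈iterate f {suc k} {suc n} x (s≤s k<n) = there (power∈iterate f (f x) k<n)

    iterate-+ : ∀ f x a b → iterate f x (a + b) ≡ iterate f x a ++ iterate f (power f a x) b
    iterate-+ f x zero    b = refl
    iterate-+ f x (suc a) b = cong (x ∷_) (iterate-+ f (f x) a b)

    module _ (_≟_ : DecidableEquality A) (x : A) where

      takeWhile-++ : ∀ {xs} ys → x ∈ xs →
        takeWhile (λ y → ¬? (y ≟ x)) (xs ++ ys) ≡ takeWhile (λ y → ¬? (y ≟ x)) xs
      takeWhile-++ {z ∷ _} ys x∈ with z ≟ x | x∈
      ... | yes _  | _          = refl
      ... | no z≢x | here x≡z   = contradiction (sym x≡z) z≢x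
      ... | no _   | there x∈xs = cong (z ∷_) (takeWhile-++ ys x∈xs)

  module _ {A B : Set} (_≟_ : DecidableEquality A) (_≟′_ : DecidableEquality B)
           (f : A → B) (f-injective : ∀ {x y} → f x ≡ f y → x ≡ y) where

    takeWhile-map : ∀ x ys → takeWhile (λ z → ¬? (z ≟′ f x)) (map f ys) ≡
                             map f (takeWhile (λ y → ¬? (y ≟ x)) ys)
    takeWhile-map x []       = refl
    takeWhile-map x (y ∷ ys) with y ≟ x | f y ≟′ f x
    ... | yes _   | yes _     = refl
    ... | no _    | no _      = cong (f y ∷_) (takeWhile-map x ys)
    ... | yes y≡x | no fy≢fx  = contradiction (cong f y≡x) fy≢fx
    ... | no y≢x  | yes fy≡fx = contradiction (f-injective fy≡fx) y≢x

  module _ {A B : Set} {P : Pred B 0ℓ} (P? : Decidable P) (f : A → B) where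

    filter-map : ∀ xs → filter P? (map f xs) ≡ map f (filter (P? ∘ f) xs)
    filter-map []       = refl
    filter-map (x ∷ xs) with P? (f x)
    ... | yes _ = cong (f x ∷_) (filter-map xs)
    ... | no  _ = filter-map xs

  ⟨$⟩ʳ-injective : ∀ {n} (u : Permutation′ n) {i j} → u ⟨$⟩ʳ i ≡ u ⟨$⟩ʳ j → i ≡ j
  ⟨$⟩ʳ-injective u = Injection.injective (↔⇒↣ u)

  -- Among the n + 1 values u⁰(i), ..., uⁿ(i) two agree, and injectivity cancels the smaller
  -- exponent, which leaves a period d + 1 ≤ n. So the n iterates that `cycleOf` inspects do reach i
  -- again.
  returns : ∀ {n} (u : Permutation′ n) i → i ∈ iterate (u ⟨$⟩ʳ_) (u ⟨$⟩ʳ i) n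
  returns {n} u i
    with a , b , a<b , eq ← Fin.pigeonhole (ℕ.n<1+n n) (λ k → power (u ⟨$⟩ʳ_) (toℕ k) i)
    with d , a+1+d≡b ← ℕ.m≤n⇒∃[o]m+o≡n a<b
    = subst (_∈ iterate f (f i) n) period (power∈iterate f (f i) d<n)
    where
    f = u ⟨$⟩ʳ_
    d<n : d < n
    d<n = ℕ.≤-trans (ℕ.≤-trans (s≤s (ℕ.m≤n+m d (toℕ a))) (ℕ.≤-reflexive a+1+d≡b))
                    (Fin.toℕ≤pred[n] b)
    period : power f (suc d) i ≡ i
    period = power-injective (⟨$⟩ʳ-injective u) (toℕ a) (begin
      power f (toℕ a) (power f (suc d) i)  ≡⟨ power-+ f (suc d) (toℕ a) i ⟨
      power f (suc d + toℕ a) i            ≡⟨ cong (λ k → power f k i) (trans (cong suc (ℕ.+-comm d (toℕ a))) a+1+d≡b) ⟩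
      power f (toℕ b) i                    ≡⟨ eq ⟨
      power f (toℕ a) i                    ∎)
      where open ≡-Reasoning

  -- The cut happens at the first return, so iterating longer changes nothing. This reconciles `u`
  -- with `fixAt j u`, whose cycles are computed with one more iterate.
  cycleOf-extend : ∀ {n} (u : Permutation′ n) i k → cycleOf u i ≡
    i ∷ takeWhile (λ j → ¬? (j Fin.≟ i)) (iterate (u ⟨$⟩ʳ_) (u ⟨$⟩ʳ i) (n + k))
  cycleOf-extend {n} u i k = cong (i ∷_) (sym (trans
    (cong (takeWhile (λ j → ¬? (j Fin.≟ i))) (iterate-+ (u ⟨$⟩ʳ_) (u ⟨$⟩ʳ i) n k))
    (takeWhile-++ Fin._≟_ i _ (returns u i))))

  Least : ∀ {n} → Permutation′ n → Fin n → Set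
  Least u i = All (i Fin.≤_) (toList (cycleOf u i))

  least? : ∀ {n} (u : Permutation′ n) → Decidable (Least u)
  least? u i = all? (i Fin.≤?_) (toList (cycleOf u i))

  cycleOf-cong : ∀ {n} {u v : Permutation′ n} → u Perm.≈ v → ∀ i → cycleOf u i ≡ cycleOf v i
  cycleOf-cong {n} {u} {v} u≈v i = cong (λ xs → i ∷ takeWhile (λ j → ¬? (j Fin.≟ i)) xs)
    (trans (iterate-cong u≈v (u ⟨$⟩ʳ i) n) (cong (λ x → iterate (v ⟨$⟩ʳ_) x n) (u≈v i)))

  markedCycleType-cong : ∀ m {n} {u v : Permutation′ n} → u Perm.≈ v →
                         markedCycleType m u ≡ markedCycleType m v
  markedCycleType-cong m {n} {u} {v} u≈v = cong (map (List⁺.map (forget m))) (trans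
    (List.map-cong (cycleOf-cong {u = u} {v} u≈v) (filter (least? u) (allFin n)))
    (cong (map (cycleOf v)) (List.filter-≐ (least? u) (least? v)
      ( (λ {i} → subst (All (i Fin.≤_) ∘ toList) (cycleOf-cong {u = u} {v} u≈v i))
      , (λ {i} → subst (All (i Fin.≤_) ∘ toList) (sym (cycleOf-cong {u = u} {v} u≈v i)))) (allFin n))))

  cycleOf-fixed : ∀ {n} (u : Permutation′ n) i → u ⟨$⟩ʳ i ≡ i → cycleOf u i ≡ i ∷ []
  cycleOf-fixed {suc n} u i ui≡i with (u ⟨$⟩ʳ i) Fin.≟ i
  ... | yes _   = refl
  ... | no ui≢i = contradiction ui≡i ui≢i

  cycleOf-fixed⁻ : ∀ {n} (u : Permutation′ n) i → cycleOf u i ≡ i ∷ [] → u ⟨$⟩ʳ i ≡ i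
  cycleOf-fixed⁻ {suc n} u i eq with (u ⟨$⟩ʳ i) Fin.≟ i
  cycleOf-fixed⁻ {suc n} u i eq | yes ui≡i = ui≡i
  cycleOf-fixed⁻ {suc n} u i () | no _

  least-fixed : ∀ {n} (u : Permutation′ n) i → u ⟨$⟩ʳ i ≡ i → Least u i
  least-fixed u i ui≡i = subst (All (i Fin.≤_) ∘ toList) (sym (cycleOf-fixed u i ui≡i)) (ℕ.≤-refl ∷ [])

  iterate-fixAt : ∀ {n} j (u : Permutation′ n) i k →
    iterate (fixAt j u ⟨$⟩ʳ_) (punchIn j i) k ≡ map (punchIn j) (iterate (u ⟨$⟩ʳ_) i k)
  iterate-fixAt j u i zero    = refl
  iterate-fixAt j u i (suc k) = cong (punchIn j i ∷_) (trans
    (cong (λ x → iterate (fixAt j u ⟨$⟩ʳ_) x k) (Perm.insert-punchIn j j u i))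
    (iterate-fixAt j u (u ⟨$⟩ʳ i) k))

  -- `punchIn j` carries the walk of `u` to that of `fixAt j u` and is injective, so both return to
  -- their start at the same step.
  cycleOf-fixAt : ∀ {n} j (u : Permutation′ n) i →
                  cycleOf (fixAt j u) (punchIn j i) ≡ List⁺.map (punchIn j) (cycleOf u i)
  cycleOf-fixAt {n} j u i = sym (begin
    List⁺.map (punchIn j) (cycleOf u i)
      ≡⟨ cong (List⁺.map (punchIn j)) (cycleOf-extend u i 1) ⟩
    punchIn j i ∷ map (punchIn j) (takeWhile (λ k → ¬? (k Fin.≟ i)) (iterate f (f i) (n + 1)))
      ≡⟨ cong (punchIn j i ∷_)
           (takeWhile-map Fin._≟_ Fin._≟_ (punchIn j) (Fin.punchIn-injective j _ _) i (iterate f (f i) (n + 1))) ⟨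
    returning (map (punchIn j) (iterate f (f i) (n + 1)))
      ≡⟨ cong returning (iterate-fixAt j u (f i) (n + 1)) ⟨
    returning (iterate f′ (punchIn j (f i)) (n + 1))
      ≡⟨ cong (λ x → returning (iterate f′ x (n + 1))) (Perm.insert-punchIn j j u i) ⟨
    returning (iterate f′ (f′ (punchIn j i)) (n + 1))
      ≡⟨ cong (λ k → returning (iterate f′ (f′ (punchIn j i)) k)) (ℕ.+-comm n 1) ⟩
    cycleOf (fixAt j u) (punchIn j i) ∎)
    where
    open ≡-Reasoning
    f = u ⟨$⟩ʳ_
    f′ = fixAt j u ⟨$⟩ʳ_
    returning : List (Fin (suc n)) → List⁺ (Fin (suc n))
    returning xs = punchIn j i ∷ takeWhile (λ k → ¬? (k Fin.≟ punchIn j i)) xs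

  least-fixAt⁺ : ∀ {n} j (u : Permutation′ n) i → Least u i → Least (fixAt j u) (punchIn j i)
  least-fixAt⁺ j u i least = subst (All (punchIn j i Fin.≤_) ∘ toList) (sym (cycleOf-fixAt j u i))
    (All.map⁺ (All.map (Fin.punchIn-mono-≤ j i _) least))

  least-fixAt⁻ : ∀ {n} j (u : Permutation′ n) i → Least (fixAt j u) (punchIn j i) → Least u i
  least-fixAt⁻ j u i least = All.map (Fin.punchIn-cancel-≤ j i _)
    (All.map⁻ (subst (All (punchIn j i Fin.≤_) ∘ toList) (cycleOf-fixAt j u i) least))

  ≤-toℕ-punchIn : ∀ {n} j (i : Fin n) → toℕ i ≤ toℕ (punchIn j i)
  ≤-toℕ-punchIn Fin.zero    i           = ℕ.n≤1+n (toℕ i)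
  ≤-toℕ-punchIn (Fin.suc j) Fin.zero    = z≤n
  ≤-toℕ-punchIn (Fin.suc j) (Fin.suc i) = s≤s (≤-toℕ-punchIn j i)

  toℕ-punchIn-< : ∀ {n} j (i : Fin n) → toℕ i < toℕ j → toℕ (punchIn j i) ≡ toℕ i
  toℕ-punchIn-< (Fin.suc j) Fin.zero    _         = refl
  toℕ-punchIn-< (Fin.suc j) (Fin.suc i) (s≤s i<j) = cong suc (toℕ-punchIn-< j i i<j)

  toℕ-punchIn-≥ : ∀ {n} j (i : Fin n) → toℕ j ≤ toℕ i → toℕ (punchIn j i) ≡ suc (toℕ i)
  toℕ-punchIn-≥ Fin.zero    i           _         = refl
  toℕ-punchIn-≥ (Fin.suc j) (Fin.suc i) (s≤s j≤i) = cong suc (toℕ-punchIn-≥ j i j≤i)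

  forget-< : ∀ m {n} (i : Fin n) (i<m : toℕ i < m) → forget m i ≡ mark (Fin.fromℕ< i<m)
  forget-< m i i<m with toℕ i ℕ.<? m
  ... | yes p  = cong mark (Fin.fromℕ<-cong _ _ refl p i<m)
  ... | no i≮m = contradiction i<m i≮m

  forget-≥ : ∀ m {n} (i : Fin n) → m ≤ toℕ i → forget m i ≡ ∗
  forget-≥ m i m≤i with toℕ i ℕ.<? m
  ... | yes i<m = contradiction m≤i (ℕ.<⇒≱ i<m)
  ... | no  _   = refl

  forget-≥⁻ : ∀ m {n} (i : Fin n) → forget m i ≡ ∗ → m ≤ toℕ i
  forget-≥⁻ m i eq with toℕ i ℕ.<? m
  forget-≥⁻ m i () | yes _
  forget-≥⁻ m i eq | no i≮m = ℕ.≮⇒≥ i≮m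

  forget-punchIn : ∀ m {n} j (i : Fin n) → m ≤ toℕ j → forget m (punchIn j i) ≡ forget m i
  forget-punchIn m j i m≤j with toℕ i ℕ.<? m
  ... | no i≮m = forget-≥ m (punchIn j i) (ℕ.≤-trans (ℕ.≮⇒≥ i≮m) (≤-toℕ-punchIn j i))
  ... | yes i<m = trans (forget-< m (punchIn j i) (subst (_< m) (sym eq) i<m))
                        (cong mark (Fin.fromℕ<-cong _ _ eq _ i<m))
    where eq = toℕ-punchIn-< j i (ℕ.≤-trans i<m m≤j)

  allFin-punchIn : ∀ {n} (j : Fin (suc n)) →
    Permutation._↭_ (setoid (Fin (suc n))) (allFin (suc n)) (j ∷ map (punchIn j) (allFin n))
  allFin-punchIn {n} j = unique⇒↭ (setoid _) (Unique≡.allFin⁺ (suc n))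
    (All.map⁺ (All.universal (λ i → Fin.punchInᵢ≢i j i ∘ sym) (allFin n))
      ∷ Unique≡.map⁺ (Fin.punchIn-injective j _ _) (Unique≡.allFin⁺ n))
    (λ {i} _ → punchIn-cases j {λ i → i ∈ j ∷ map (punchIn j) (allFin n)} (here refl)
                 (λ i → there (∈.∈-map⁺ (punchIn j) (∈.∈-allFin i))) i)
    (λ {i} _ → ∈.∈-allFin i)

  module ≋ {A : Set} where
    open Permutation (cycleSetoid {A}) public
    open Permutationₚ (cycleSetoid {A}) public

  ∼-map : ∀ {A B : Set} (f : A → B) {c d : List⁺ A} → c ∼ d → List⁺.map f c ∼ List⁺.map f d
  ∼-map f {_ ∷ _} {_ ∷ _} (us , vs , p , q) =
    map f us , map f vs , trans (cong (map f) p) (List.map-++ f us vs)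
                        , trans (cong (map f) q) (List.map-++ f vs us)

  -- `punchIn j` is monotone, so every other cycle is still written from the image of its old
  -- starting point, and m ≤ j leaves the marks in place. The inserted point is unmarked and forms a
  -- cycle by itself.
  markedCycleType-fixAt : ∀ m {n} j (u : Permutation′ n) → m ≤ toℕ j →
                          markedCycleType m (fixAt j u) ≋ (∗ ∷ []) ∷ markedCycleType m u
  markedCycleType-fixAt m {n} j u m≤j = ≋.↭-trans reorder (≋.↭-reflexive (begin
    type (filter (least? u′) (j ∷ map (punchIn j) (allFin n)))
      ≡⟨ cong type (List.filter-accept (least? u′) (least-fixed u′ j (fixAt-fixes j u))) ⟩
    type (j ∷ filter (least? u′) (map (punchIn j) (allFin n)))
      ≡⟨ cong (type ∘ (j ∷_)) (trans (filter-map (least? u′) (punchIn j) (allFin n))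
           (cong (map (punchIn j)) (List.filter-≐ _ (least? u)
             ((λ {i} → least-fixAt⁻ j u i) , (λ {i} → least-fixAt⁺ j u i)) (allFin n)))) ⟩
    type (j ∷ map (punchIn j) (filter (least? u) (allFin n)))
      ≡⟨ cong₂ _∷_ first (rest (filter (least? u) (allFin n))) ⟩
    (∗ ∷ []) ∷ markedCycleType m u ∎))
    where
    open ≡-Reasoning
    u′ = fixAt j u

    type : List (Fin (suc n)) → List (List⁺ (Letter m))
    type is = map (List⁺.map (forget m)) (map (cycleOf u′) is)

    -- In the cycle notation `j` stands in its numerical place; bringing it to the front is the only
    -- step that reorders cycles.
    reorder : markedCycleType m u′ ≋ type (filter (least? u′) (j ∷ map (punchIn j) (allFin n)))
    reorder = Permutationₚ.map⁺ cycleSetoid cycleSetoid (λ {c} {d} → ∼-map (forget m) {c} {d})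
      (Permutationₚ.map⁺ (setoid _) cycleSetoid (λ { refl → ∼-refl })
        (Permutationₚ.filter⁺ (setoid _) (least? u′) (λ { refl p → p }) (allFin-punchIn j)))

    first : List⁺.map (forget m) (cycleOf u′ j) ≡ ∗ ∷ []
    first = trans (cong (List⁺.map (forget m)) (cycleOf-fixed u′ j (fixAt-fixes j u)))
                  (cong (_∷ []) (forget-≥ m j m≤j))

    same : ∀ i → List⁺.map (forget m) (cycleOf u′ (punchIn j i)) ≡ List⁺.map (forget m) (cycleOf u i)
    same i = trans (cong (List⁺.map (forget m)) (cycleOf-fixAt j u i))
      (cong₂ _∷_ (forget-punchIn m j i m≤j)
        (trans (sym (List.map-∘ (List⁺.tail (cycleOf u i))))
          (List.map-cong (λ k → forget-punchIn m j k m≤j) (List⁺.tail (cycleOf u i)))))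

    rest : ∀ is → type (map (punchIn j) is) ≡ map (List⁺.map (forget m)) (map (cycleOf u) is)
    rest []       = refl
    rest (i ∷ is) = cong₂ _∷_ (same i) (rest is)

  -- Fixed points outside [m] and trivial cycles

  FixedPoint : ∀ m {n} → Permutation′ n → Fin n → Set
  FixedPoint m u i = m ≤ toℕ i × u ⟨$⟩ʳ i ≡ i

  fixedPoint? : ∀ m {n} (u : Permutation′ n) → Decidable (FixedPoint m u)
  fixedPoint? m u i = (m ℕ.≤? toℕ i) ×-dec (u ⟨$⟩ʳ i Fin.≟ i)

  -- The number `m₁`, on bare lists of words, since the cycle type of a permutation is not packaged
  -- as a `Shape`.
  trivialCycles : ∀ {m} → List (List⁺ (Letter m)) → ℕ
  trivialCycles cs = length (filter (_≟ᶜ (∗ ∷ [])) cs)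

  ∼-trivial : ∀ {m} {c d : List⁺ (Letter m)} → c ∼ d → c ≡ ∗ ∷ [] → d ≡ ∗ ∷ []
  ∼-trivial {d = _ ∷ _} ([]         , vs , refl , q) refl with refl ← q = refl
  ∼-trivial {d = _ ∷ _} (x ∷ []     , [] , refl , q) refl with refl ← q = refl

  trivialCycles-≋ : ∀ {m} {cs ds : List (List⁺ (Letter m))} → cs ≋ ds → trivialCycles cs ≡ trivialCycles ds
  trivialCycles-≋ cs≋ds = ≋.xs↭ys⇒|xs|≡|ys| (≋.filter⁺ (_≟ᶜ (∗ ∷ [])) (λ {c} {d} → ∼-trivial {c = c} {d}) cs≋ds)

  -- By properness the added cycles are the only trivial ones.
  trivialCycles-pad : ∀ {m} (cs : List (List⁺ (Letter m))) k → trivialCycles cs ≡ 0 →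
                      trivialCycles (cs ++ replicate k (∗ ∷ [])) ≡ k
  trivialCycles-pad cs k proper = trans (cong length (List.filter-++ _ cs _))
    (trans (List.length-++ (filter (_≟ᶜ (∗ ∷ [])) cs)) (cong₂ _+_ proper (trivial k)))
    where
    trivial : ∀ k → trivialCycles (replicate k (∗ ∷ [])) ≡ k
    trivial zero    = refl
    trivial (suc k) = cong suc (trivial k)

  -- A cycle reads (∗) exactly when it consists of one fixed point outside [m]; a fixed point in [m]
  -- would read (a). A fixed point is least in its cycle, so the selection of starting points drops
  -- none.
  trivialCycles-type : ∀ m {n} (u : Permutation′ n) →
    trivialCycles (markedCycleType m u) ≡ length (filter (fixedPoint? m u) (allFin n))
  trivialCycles-type m {n} u = count-all (allFin n)
    where
    trivial⁻ : ∀ i → List⁺.map (forget m) (cycleOf u i) ≡ ∗ ∷ [] → FixedPoint m u i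
    trivial⁻ i eq = forget-≥⁻ m i (cong List⁺.head eq)
                  , cycleOf-fixed⁻ u i (cong (i ∷_) (tail-[] (cong List⁺.tail eq)))
      where
      tail-[] : ∀ {xs} → map (forget m) xs ≡ [] → xs ≡ []
      tail-[] {[]} _ = refl

    trivial⁺ : ∀ i → FixedPoint m u i → List⁺.map (forget m) (cycleOf u i) ≡ ∗ ∷ []
    trivial⁺ i (m≤i , ui≡i) = trans (cong (List⁺.map (forget m)) (cycleOf-fixed u i ui≡i))
                                    (cong (_∷ []) (forget-≥ m i m≤i))

    count-all : ∀ is → trivialCycles (map (List⁺.map (forget m)) (map (cycleOf u) (filter (least? u) is)))
                       ≡ length (filter (fixedPoint? m u) is)
    count-all []       = refl
    count-all (i ∷ is) = by (least? u i) (fixedPoint? m u i) (List⁺.map (forget m) (cycleOf u i) ≟ᶜ (∗ ∷ []))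
      where
      c = List⁺.map (forget m) (cycleOf u i)
      cs = map (List⁺.map (forget m)) (map (cycleOf u) (filter (least? u) is))
      by : Dec (Least u i) → Dec (FixedPoint m u i) → Dec (c ≡ ∗ ∷ []) →
           trivialCycles (map (List⁺.map (forget m)) (map (cycleOf u) (filter (least? u) (i ∷ is))))
           ≡ length (filter (fixedPoint? m u) (i ∷ is))
      by (no ¬least) (yes fp) _ = contradiction (least-fixed u i (proj₂ fp)) ¬least
      by (no ¬least) (no ¬fp) _
        rewrite List.filter-reject (least? u) {xs = is} ¬least | List.filter-reject (fixedPoint? m u) {xs = is} ¬fp
        = count-all is
      by (yes _) (yes fp) (no c≢) = contradiction (trivial⁺ i fp) c≢
      by (yes _) (no ¬fp) (yes c≡) = contradiction (trivial⁻ i c≡) ¬fp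
      by (yes least) (yes fp) (yes c≡)
        rewrite List.filter-accept (least? u) {xs = is} least | List.filter-accept (fixedPoint? m u) {xs = is} fp
        = trans (cong length (List.filter-accept (_≟ᶜ (∗ ∷ [])) {x = c} {cs} c≡)) (cong suc (count-all is))
      by (yes least) (no ¬fp) (no c≢)
        rewrite List.filter-accept (least? u) {xs = is} least | List.filter-reject (fixedPoint? m u) {xs = is} ¬fp
        = trans (cong length (List.filter-reject (_≟ᶜ (∗ ∷ [])) {x = c} {cs} c≢)) (count-all is)

  -- A permutation of each type

  module _ {A : Set} where

    unique-++⁻ : ∀ (xs : List A) {ys} → Unique (xs ++ ys) →
                 Unique xs × Unique ys × (∀ {x} → x ∈ xs → x ∉ ys)
    unique-++⁻ []       u          = [] , u , λ ()
    unique-++⁻ (x ∷ xs) (x∉ ∷ u) with xs! , ys! , disjoint ← unique-++⁻ xs u =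
      All.++⁻ˡ xs x∉ ∷ xs! , ys! , λ
        { (here refl) x∈ys → All.All¬⇒¬Any (All.++⁻ʳ xs x∉) x∈ys
        ; (there x∈xs)     → disjoint x∈xs }

    unique-rotate : ∀ (xs ys : List A) → Unique (xs ++ ys) → Unique (ys ++ xs)
    unique-rotate xs ys = Permutationₚ.Unique-resp-↭ (setoid A) (Permutationₚ.++-comm (setoid A) xs ys)

    -- The walk of `f` from `x` runs through `ys` in order and then arrives at `z`. When it arrives
    -- at its own start, the word is a cycle of `f`; this is `Closed`.
    Chain : (A → A) → A → List A → A → Set
    Chain f x []       z = f x ≡ z
    Chain f x (y ∷ ys) z = f x ≡ y × Chain f y ys z

    chain-++⁺ : ∀ {f} x ys {y} zs {z} → Chain f x ys y → Chain f y zs z → Chain f x (ys ++ y ∷ zs) z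
    chain-++⁺ x []       zs p       q = p , q
    chain-++⁺ x (w ∷ ys) zs (e , p) q = e , chain-++⁺ w ys zs p q

    chain-++⁻ : ∀ {f} x ys {y} zs {z} → Chain f x (ys ++ y ∷ zs) z → Chain f x ys y × Chain f y zs z
    chain-++⁻ x []       zs (e , q) = e , q
    chain-++⁻ x (w ∷ ys) zs (e , q) with p , q′ ← chain-++⁻ w ys zs q = (e , p) , q′

    -- Composition with a `g` that moves none of the points passed redirects the last step only.
    -- Multiplying by a transposition lengthens a cycle in this way.
    chain-∘ : ∀ {f g : A → A} x ys {y z} → (∀ {w} → w ∈ ys → g w ≡ w) → g y ≡ z →
              Chain f x ys y → Chain (g ∘ f) x ys z
    chain-∘ {g = g} x []       fix e p       = trans (cong g p) e
    chain-∘ {g = g} x (y ∷ ys) fix e (q , p) =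
      trans (cong g q) (fix (here refl)) , chain-∘ y ys (fix ∘ there) e p

    chain-cong : ∀ {f g : A → A} x ys {z} → (∀ {w} → w ∈ x ∷ ys → g w ≡ f w) → Chain f x ys z → Chain g x ys z
    chain-cong x []       eq p       = trans (eq (here refl)) p
    chain-cong x (y ∷ ys) eq (q , p) = trans (eq (here refl)) q , chain-cong y ys (eq ∘ there) p

    chain-iterate : ∀ {f} x ys {z} n → Chain f x ys z → iterate f (f x) (length ys + n) ≡ ys ++ iterate f z n
    chain-iterate {f} x []       n p       = cong (λ y → iterate f y n) p
    chain-iterate     x (y ∷ ys) n (refl , p) = cong (_ ∷_) (chain-iterate y ys n p)

    Closed : (A → A) → List⁺ A → Set
    Closed f (x ∷ xs) = Chain f x xs x

  module _ {n : ℕ} where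

    takeWhile-prefix : ∀ {x : Fin n} ys zs → x ∉ ys →
                       takeWhile (λ y → ¬? (y Fin.≟ x)) (ys ++ x ∷ zs) ≡ ys
    takeWhile-prefix {x} []       zs _ with x Fin.≟ x
    ... | yes _  = refl
    ... | no x≢x = contradiction refl x≢x
    takeWhile-prefix {x} (y ∷ ys) zs x∉ with y Fin.≟ x
    ... | yes y≡x = contradiction (here (sym y≡x)) x∉
    ... | no  _   = cong (y ∷_) (takeWhile-prefix ys zs (x∉ ∘ there))

    -- The letters are distinct, so the first return is at the end of the word. Adding
    -- `suc (length xs)` iterates makes the walk longer than the word without any comparison of its
    -- length with n.
    cycleOf-closed : ∀ (u : Permutation′ n) x xs → Unique (x ∷ xs) → Closed (u ⟨$⟩ʳ_) (x ∷ xs) →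
                     cycleOf u x ≡ x ∷ xs
    cycleOf-closed u x xs (x∉xs ∷ _) closed = trans (cycleOf-extend u x (suc (length xs)))
      (cong (x ∷_) (trans
        (cong (takeWhile (λ j → ¬? (j Fin.≟ x))) (trans
          (cong (iterate (u ⟨$⟩ʳ_) (u ⟨$⟩ʳ x)) (trans (ℕ.+-suc n (length xs)) (ℕ.+-comm (suc n) (length xs))))
          (chain-iterate x xs (suc n) closed)))
        (takeWhile-prefix xs _ (All.All¬⇒¬Any x∉xs))))

    -- A closed walk stays closed when started at another of its points; the word is then rotated,
    -- which `_∼_` ignores.
    cycleOf-member : ∀ (u : Permutation′ n) c → Unique (toList c) → Closed (u ⟨$⟩ʳ_) c →
                     ∀ {x} → x ∈ toList c → cycleOf u x ∼ c
    cycleOf-member u (z ∷ zs) c! closed {x} x∈c with ∈.∈-∃++ x∈c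
    ... | [] , vs , refl =
      x ∷ vs , []
      , trans (cong toList (cycleOf-closed u x vs c! closed)) (sym (List.++-identityʳ _))
      , refl
    ... | z ∷ us , vs , refl with p , q ← chain-++⁻ z us vs closed =
      x ∷ vs , z ∷ us
      , cong toList (cycleOf-closed u x (vs ++ z ∷ us)
          (unique-rotate (z ∷ us) (x ∷ vs) c!) (chain-++⁺ x vs us q p))
      , refl

    transpose-x : ∀ (x y : Fin n) → Perm.transpose x y ⟨$⟩ʳ x ≡ y
    transpose-x x y with x Fin.≟ x
    ... | yes _  = refl
    ... | no x≢x = contradiction refl x≢x

    transpose-y : ∀ (x y : Fin n) → Perm.transpose x y ⟨$⟩ʳ y ≡ x
    transpose-y x y with y Fin.≟ x
    ... | yes y≡x = y≡x
    ... | no  _ with y Fin.≟ y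
    ...   | yes _  = refl
    ...   | no y≢y = contradiction refl y≢y

    transpose-≢ : ∀ (x y : Fin n) {z} → z ≢ x → z ≢ y → Perm.transpose x y ⟨$⟩ʳ z ≡ z
    transpose-≢ x y {z} z≢x z≢y with z Fin.≟ x
    ... | yes z≡x = contradiction z≡x z≢x
    ... | no  _ with z Fin.≟ y
    ...   | yes z≡y = contradiction z≡y z≢y
    ...   | no  _   = refl

    -- The factorisation (x y z ...) = (x y)(y z)... into transpositions, the rightmost acting
    -- first.
    cycle : Fin n → List (Fin n) → Permutation′ n
    cycle x []       = Perm.id
    cycle x (y ∷ ys) = Perm.transpose x y · cycle y ys

    cycle-∉ : ∀ x xs {z} → z ∉ x ∷ xs → cycle x xs ⟨$⟩ʳ z ≡ z
    cycle-∉ x []       z∉ = refl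
    cycle-∉ x (y ∷ ys) z∉ = trans (cong (Perm.transpose x y ⟨$⟩ʳ_) (cycle-∉ y ys (z∉ ∘ there)))
                                  (transpose-≢ x y (z∉ ∘ here) (z∉ ∘ there ∘ here))

    cycle-closed : ∀ x xs → Unique (x ∷ xs) → Closed (cycle x xs ⟨$⟩ʳ_) (x ∷ xs)
    cycle-closed x []       _ = refl
    cycle-closed x (y ∷ ys) ((x≢y ∷ x∉ys) ∷ ys!@(y∉ys ∷ _)) =
      trans (cong (Perm.transpose x y ⟨$⟩ʳ_) (cycle-∉ y ys (All.All¬⇒¬Any (x≢y ∷ x∉ys)))) (transpose-x x y)
      , chain-∘ y ys (λ w∈ys → transpose-≢ x y (λ w≡x → All.lookup x∉ys w∈ys (sym w≡x))
                                               (λ w≡y → All.lookup y∉ys w∈ys (sym w≡y)))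
                     (transpose-y x y) (cycle-closed y ys ys!)

    fromCycles : List (List⁺ (Fin n)) → Permutation′ n
    fromCycles []              = Perm.id
    fromCycles ((x ∷ xs) ∷ cs) = cycle x xs · fromCycles cs

    fromCycles-∉ : ∀ cs {z} → z ∉ letters cs → fromCycles cs ⟨$⟩ʳ z ≡ z
    fromCycles-∉ []              z∉ = refl
    fromCycles-∉ ((x ∷ xs) ∷ cs) z∉ = trans
      (cong (cycle x xs ⟨$⟩ʳ_) (fromCycles-∉ cs (z∉ ∘ ∈.∈-++⁺ʳ (x ∷ xs))))
      (cycle-∉ x xs (z∉ ∘ ∈.∈-++⁺ˡ))

    ∈-letters : ∀ {A : Set} {cs : List (List⁺ A)} {c x} → x ∈ toList c → c ∈ cs → x ∈ letters cs
    ∈-letters x∈c c∈cs = ∈.∈-concatMap⁺ toList (lose c∈cs x∈c)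

    -- The words have disjoint letters: the later cycles fix the letters of the first word, and the
    -- first cycle fixes the letters of the later words.
    fromCycles-closed : ∀ cs → Unique (letters cs) → All (Closed (fromCycles cs ⟨$⟩ʳ_)) cs
    fromCycles-closed []              _ = []
    fromCycles-closed ((x ∷ xs) ∷ cs) u with c! , cs! , disjoint ← unique-++⁻ (x ∷ xs) u =
      chain-cong x xs (λ w∈ → cong (cycle x xs ⟨$⟩ʳ_) (fromCycles-∉ cs (disjoint w∈))) (cycle-closed x xs c!)
      ∷ All.tabulate λ { {y ∷ ys} d∈cs → chain-∘ y ys
          (λ w∈ → cycle-∉ x xs (λ w∈c → disjoint w∈c (∈-letters (there w∈) d∈cs)))
          (cycle-∉ x xs (λ y∈c → disjoint y∈c (∈-letters (here refl) d∈cs)))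
          (All.lookup (fromCycles-closed cs cs!) d∈cs) }

    minimum : ∀ (x : Fin n) xs → ∃ λ l → l ∈ x ∷ xs × All (l Fin.≤_) (x ∷ xs)
    minimum x []       = x , here refl , ℕ.≤-refl ∷ []
    minimum x (y ∷ ys) with l , l∈ , l≤ ← minimum y ys with Fin.≤-total l x
    ... | inj₁ l≤x = l , there l∈ , l≤x ∷ l≤
    ... | inj₂ x≤l = x , here refl , ℕ.≤-refl ∷ All.map (ℕ.≤-trans x≤l) l≤

    min : List⁺ (Fin n) → Fin n
    min (x ∷ xs) = proj₁ (minimum x xs)

    min∈ : ∀ c → min c ∈ toList c
    min∈ (x ∷ xs) = proj₁ (proj₂ (minimum x xs))

    min≤ : ∀ c → All (min c Fin.≤_) (toList c)
    min≤ (x ∷ xs) = proj₂ (proj₂ (minimum x xs))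

    All-∼ : ∀ {A : Set} {P : Pred A 0ℓ} {c d : List⁺ A} → c ∼ d → All P (toList c) → All P (toList d)
    All-∼ {P = P} (us , vs , p , q) all = subst (All P) (sym q) (All.++⁺ (All.++⁻ʳ us all′) (All.++⁻ˡ us all′))
      where all′ = subst (All P) p all

    -- The starting points in the cycle notation are the minima of the words. They are distinct
    -- because the words are disjoint, and the cycle written from a minimum is a rotation of its
    -- word.
    cycleNotation-closed : ∀ (u : Permutation′ n) cs → Unique (letters cs) → (∀ i → i ∈ letters cs) →
                           All (Closed (u ⟨$⟩ʳ_)) cs → cycleNotation u ≋ cs
    cycleNotation-closed u cs cs! covers closed =
      ≋.↭-trans (Permutationₚ.map⁺ (setoid _) cycleSetoid (λ { refl → ∼-refl })
                  (unique⇒↭ (setoid _) (Unique≡.filter⁺ (least? u) (Unique≡.allFin⁺ n))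
                    (mins! cs cs!) (λ {i} → to {i}) (λ {i} → from {i})))
                (pointwise cs (λ c∈ → c∈))
      where
      word! : ∀ {c} cs → c ∈ cs → Unique (letters cs) → Unique (toList c)
      word! (c ∷ cs) (here refl) u = proj₁ (unique-++⁻ (toList c) u)
      word! (c ∷ cs) (there c∈)  u = word! cs c∈ (proj₁ (proj₂ (unique-++⁻ (toList c) u)))

      cycleOf∼ : ∀ {c i} → c ∈ cs → i ∈ toList c → cycleOf u i ∼ c
      cycleOf∼ {c} c∈ i∈ = cycleOf-member u c (word! cs c∈ cs!) (All.lookup closed c∈) i∈

      mins! : ∀ ds → Unique (letters ds) → Unique (map min ds)
      mins! []       _ = []
      mins! (d ∷ ds) u with _ , ds! , disjoint ← unique-++⁻ (toList d) u =
        All.map⁺ (All.tabulate λ {e} e∈ eq →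
          disjoint (min∈ d) (subst (_∈ letters ds) (sym eq) (∈-letters (min∈ e) e∈)))
        ∷ mins! ds ds!

      to : ∀ {i} → i ∈ filter (least? u) (allFin n) → i ∈ map min cs
      to {i} i∈ with c , c∈ , i∈c ← find (∈.∈-concatMap⁻ toList {xs = cs} (covers i)) =
        subst (_∈ map min cs)
          (Fin.≤-antisym (All.lookup (min≤ c) i∈c)
            (All.lookup (All-∼ {c = cycleOf u i} {c} (cycleOf∼ c∈ i∈c)
              (proj₂ (∈.∈-filter⁻ (least? u) {xs = allFin n} i∈))) (min∈ c)))
          (∈.∈-map⁺ min c∈)

      from : ∀ {i} → i ∈ map min cs → i ∈ filter (least? u) (allFin n)
      from i∈ with c , c∈ , refl ← ∈.∈-map⁻ min {xs = cs} i∈ =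
        ∈.∈-filter⁺ (least? u) (∈.∈-allFin (min c))
          (All-∼ {c = c} {cycleOf u (min c)} (∼-sym {c = cycleOf u (min c)} {c} (cycleOf∼ c∈ (min∈ c))) (min≤ c))

      pointwise : ∀ ds → (∀ {d} → d ∈ ds → d ∈ cs) → map (cycleOf u) (map min ds) ≋ ds
      pointwise []       _     = ≋.↭-refl
      pointwise (d ∷ ds) ds⊆cs = ≋.prep {Fin n} (cycleOf∼ (ds⊆cs (here refl)) (min∈ d)) (pointwise ds (ds⊆cs ∘ there))

  -- Numbering the occurrences of ∗ in a shape

  module _ {m : ℕ} where

    -- A mark names its own point, while each ∗ needs a point of its own beyond m. `Fin.join` later
    -- sends `inj₁ a` to a and `inj₂ k` to m + k, which fills `Fin ∣ ρ ∣`.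
    Label : ℕ → Set
    Label s = Fin m ⊎ Fin s

    unlabel : ∀ {s} → Label s → Letter m
    unlabel = Sum.[ just , const nothing ]

    label : (xs : List (Letter m)) → List (Label (occ ∗ xs))
    label []            = []
    label (∗ ∷ xs)      = inj₂ Fin.zero ∷ map (Sum.map₂ Fin.suc) (label xs)
    label (mark a ∷ xs) = inj₁ a ∷ label xs

    unlabel-map₂ : ∀ {s t} (f : Fin s → Fin t) x → unlabel (Sum.map₂ f x) ≡ unlabel x
    unlabel-map₂ f (inj₁ a) = refl
    unlabel-map₂ f (inj₂ k) = refl

    map-unlabel : ∀ xs → map unlabel (label xs) ≡ xs
    map-unlabel []            = refl
    map-unlabel (∗ ∷ xs)      = cong (∗ ∷_) (trans (sym (List.map-∘ (label xs)))
      (trans (List.map-cong (unlabel-map₂ Fin.suc) (label xs)) (map-unlabel xs)))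
    map-unlabel (mark a ∷ xs) = cong (mark a ∷_) (map-unlabel xs)

    occ⇒∈ : ∀ x (xs : List (Letter m)) → occ x xs ≢ 0 → x ∈ xs
    occ⇒∈ x xs occ≢0 with any? (x ≟ˡ_) xs
    ... | yes x∈ = x∈
    ... | no  x∉ = contradiction (cong length (List.filter-none (x ≟ˡ_) (All.¬Any⇒All¬ xs x∉))) occ≢0

    ∈⇒occ : ∀ {x} {xs : List (Letter m)} → x ∈ xs → 0 < occ x xs
    ∈⇒occ {x} x∈ = List.filter-some (x ≟ˡ_) x∈

    occ-here : ∀ x (xs : List (Letter m)) → occ x (x ∷ xs) ≡ suc (occ x xs)
    occ-here x xs = cong length (List.filter-accept (x ≟ˡ_) {xs = xs} refl)

    occ-tail : ∀ x y (xs : List (Letter m)) → occ x xs ≤ occ x (y ∷ xs)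
    occ-tail x y xs = subst (occ x xs ≤_) (sym (occ-++ x (y ∷ []) xs)) (ℕ.m≤n+m (occ x xs) _)

    label-covers-marks : ∀ xs a → mark a ∈ xs → inj₁ a ∈ label xs
    label-covers-marks (∗ ∷ xs)      a (there a∈) =
      there (∈.∈-map⁺ (Sum.map₂ Fin.suc) (label-covers-marks xs a a∈))
    label-covers-marks (mark a ∷ xs) a (here refl) = here refl
    label-covers-marks (mark b ∷ xs) a (there a∈)  = there (label-covers-marks xs a a∈)

    label-covers-∗ : ∀ xs k → inj₂ k ∈ label xs
    label-covers-∗ (∗ ∷ xs)      Fin.zero    = here refl
    label-covers-∗ (∗ ∷ xs)      (Fin.suc k) = there (∈.∈-map⁺ (Sum.map₂ Fin.suc) (label-covers-∗ xs k))
    label-covers-∗ (mark a ∷ xs) k           = there (label-covers-∗ xs k)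

    map₂-suc-injective : ∀ {s} {x y : Label s} → Sum.map₂ Fin.suc x ≡ Sum.map₂ Fin.suc y → x ≡ y
    map₂-suc-injective {x = inj₁ _} {inj₁ _} refl = refl
    map₂-suc-injective {x = inj₂ _} {inj₂ _} refl = refl

    -- The hypothesis is an inequality because the equation `once` does not pass to tails of the
    -- list.
    label! : ∀ xs → (∀ a → occ (mark a) xs ≤ 1) → Unique (label xs)
    label! []            _    = []
    label! (∗ ∷ xs)      once = All.map⁺ (All.universal (λ { (inj₁ _) () ; (inj₂ _) () }) (label xs))
      ∷ Unique≡.map⁺ map₂-suc-injective (label! xs (λ a → ℕ.≤-trans (occ-tail (mark a) ∗ xs) (once a)))
    label! (mark a ∷ xs) once = All.¬Any⇒All¬ (label xs) a∉
      ∷ label! xs (λ b → ℕ.≤-trans (occ-tail (mark b) (mark a) xs) (once b))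
      where
      a∉ : inj₁ a ∉ label xs
      a∉ a∈ = ℕ.<⇒≱ (∈⇒occ (subst (mark a ∈_) (map-unlabel xs) (∈.∈-map⁺ unlabel a∈)))
                    (ℕ.s≤s⁻¹ (subst (_≤ 1) (occ-here (mark a) xs) (once a)))

    forget-join : ∀ {s} (x : Label s) → forget m (Fin.join m s x) ≡ unlabel x
    forget-join {s} (inj₁ a) = trans (forget-< m (a Fin.↑ˡ s) (subst (_< m) (sym (Fin.toℕ-↑ˡ a s)) (Fin.toℕ<n a)))
      (cong mark (Fin.toℕ-injective (trans (Fin.toℕ-fromℕ< _) (Fin.toℕ-↑ˡ a s))))
    forget-join {s} (inj₂ k) = forget-≥ m (m Fin.↑ʳ k) (subst (m ≤_) (sym (Fin.toℕ-↑ʳ m k)) (ℕ.m≤m+n m (toℕ k)))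

  module _ {A B : Set} (g : A → B) where

    map-split : ∀ as (bs₁ : List B) {bs₂} → map g as ≡ bs₁ ++ bs₂ →
                ∃ λ as₁ → ∃ λ as₂ → as ≡ as₁ ++ as₂ × map g as₁ ≡ bs₁ × map g as₂ ≡ bs₂
    map-split as       []        eq = [] , as , refl , refl , eq
    map-split (a ∷ as) (b ∷ bs₁) eq
      with as₁ , as₂ , refl , eq₁ , eq₂ ← map-split as bs₁ (∷-injectiveʳ eq) =
      a ∷ as₁ , as₂ , refl , cong₂ _∷_ (∷-injectiveˡ eq) eq₁ , eq₂

    -- Transfers the division of the letters into words to a list of points lying over them, which
    -- turns the numbered letters into cycles.
    split-words : ∀ as (cs : List (List⁺ B)) → map g as ≡ letters cs →
                  ∃ λ ds → letters ds ≡ as × map (List⁺.map g) ds ≡ cs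
    split-words []       []              eq = [] , refl , refl
    split-words (a ∷ as) ((b ∷ bs) ∷ cs) eq
      with as₁ , as₂ , refl , eq₁ , eq₂ ← map-split as bs (∷-injectiveʳ eq)
      with ds , refl , eq₃ ← split-words as₂ cs eq₂ =
      (a ∷ as₁) ∷ ds , refl , cong₂ _∷_ (cong₂ _∷_ (∷-injectiveˡ eq) eq₁) eq₃

  -- Each letter of `ρ` is replaced by a point of its own, and the words are read as cycles;
  -- `forget` undoes the replacement. The coefficient of `ρ` is evaluated at this permutation.
  realize : ∀ {m} (ρ : Shape m) → ∃ λ (w : Permutation′ ∣ ρ ∣) → markedCycleType m w ≋ cycles ρ
  realize {m} ρ = fromCycles ds , ≋.↭-trans
      (Permutationₚ.map⁺ cycleSetoid cycleSetoid (λ {c} {d} → ∼-map (forget m) {c} {d})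
        (cycleNotation-closed (fromCycles ds) ds ds! covers (fromCycles-closed ds ds!)))
      (≋.↭-reflexive type≡)
    where
    xs = letters (cycles ρ)
    points = map (Fin.join m (occ ∗ xs)) (label xs)

    forget-points : map (forget m) points ≡ xs
    forget-points = trans (sym (List.map-∘ (label xs))) (trans (List.map-cong forget-join (label xs)) (map-unlabel xs))

    words = split-words (forget m) points (cycles ρ) forget-points
    ds = proj₁ words
    letters≡ = proj₁ (proj₂ words)
    type≡ = proj₂ (proj₂ words)

    join-injective : ∀ {x y : Fin m ⊎ Fin (occ ∗ xs)} → Fin.join m _ x ≡ Fin.join m _ y → x ≡ y
    join-injective {x} {y} eq = trans (sym (Fin.splitAt-join m _ x))
      (trans (cong (Fin.splitAt m) eq) (Fin.splitAt-join m _ y))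

    ds! : Unique (letters ds)
    ds! = subst Unique (sym letters≡) (Unique≡.map⁺ join-injective (label! xs (λ a → ℕ.≤-reflexive (once ρ a))))

    covered : ∀ x → x ∈ label xs
    covered (inj₁ a) = label-covers-marks xs a (occ⇒∈ (mark a) xs λ eq → contradiction (trans (sym (once ρ a)) eq) λ ())
    covered (inj₂ k) = label-covers-∗ xs k

    covers : ∀ i → i ∈ letters ds
    covers i = subst (i ∈_) (sym letters≡)
      (subst (_∈ points) (Fin.join-splitAt m _ i) (∈.∈-map⁺ _ (covered (Fin.splitAt m i))))

  -- Fixed points of a product

  module _ {m : ℕ} where

    -- The bound guards the truncated subtraction. The recurrence passes through values of n with
    -- |ρ| ≤ n that may lie below |κ| or |δ|, and there no permutation is to be counted.
    HasType : Shape m → ∀ {n} → Permutation′ n → Set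
    HasType κ {n} u = ∣ κ ∣ ≤ n × markedCycleType m u ≋ cycles κ ++ replicate (n ∸ ∣ κ ∣) (∗ ∷ [])

    hasType? : ∀ κ {n} → Decidable (HasType κ {n})
    hasType? κ {n} u = (∣ κ ∣ ℕ.≤? n) ×-dec
      (_≋?_ _≟ˡ_ (markedCycleType m u) (cycles κ ++ replicate (n ∸ ∣ κ ∣) (∗ ∷ [])))

    hasType-resp : ∀ κ {n} {u v : Permutation′ n} → u Perm.≈ v → HasType κ u → HasType κ v
    hasType-resp κ {u = u} {v} u≈v (h , t) = h , subst (_≋ _) (markedCycleType-cong m {u = u} {v} u≈v) t

    hasType-fixAt⁺ : ∀ κ {n} j (u : Permutation′ n) → m ≤ toℕ j → HasType κ u → HasType κ (fixAt j u)
    hasType-fixAt⁺ κ {n} j u m≤j (h , t) = ℕ.m≤n⇒m≤1+n h , (begin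
      markedCycleType m (fixAt j u)                               ↭⟨ markedCycleType-fixAt m j u m≤j ⟩
      (∗ ∷ []) ∷ markedCycleType m u                              ↭⟨ ≋.↭-prep (∗ ∷ []) t ⟩
      (∗ ∷ []) ∷ cycles κ ++ replicate (n ∸ ∣ κ ∣) (∗ ∷ [])       ↭⟨ ≋.↭-shift (cycles κ) _ ⟨
      cycles κ ++ replicate (suc (n ∸ ∣ κ ∣)) (∗ ∷ [])            ≡⟨ cong padded (ℕ.+-∸-assoc 1 h) ⟨
      cycles κ ++ replicate (suc n ∸ ∣ κ ∣) (∗ ∷ [])              ∎)
      where
      open ≋.PermutationReasoning
      padded = λ k → cycles κ ++ replicate k (∗ ∷ [])

    -- One trivial cycle cancels on both sides if n ≥ |κ|. Otherwise |κ| = n + 1, and the trivial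
    -- cycle of `j` would have to occur in `κ` itself, against properness.
    hasType-fixAt⁻ : ∀ κ → Proper κ → ∀ {n} j (u : Permutation′ n) → m ≤ toℕ j →
                     HasType κ (fixAt j u) → HasType κ u
    hasType-fixAt⁻ κ proper {n} j u m≤j (h , t) with ∣ κ ∣ ℕ.≤? n
    ... | yes h′ = h′ , ≋.drop-∷ (begin
      (∗ ∷ []) ∷ markedCycleType m u                              ↭⟨ markedCycleType-fixAt m j u m≤j ⟨
      markedCycleType m (fixAt j u)                               ↭⟨ t ⟩
      cycles κ ++ replicate (suc n ∸ ∣ κ ∣) (∗ ∷ [])              ≡⟨ cong padded (ℕ.+-∸-assoc 1 h′) ⟩
      cycles κ ++ replicate (suc (n ∸ ∣ κ ∣)) (∗ ∷ [])            ↭⟨ ≋.↭-shift (cycles κ) _ ⟩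
      (∗ ∷ []) ∷ cycles κ ++ replicate (n ∸ ∣ κ ∣) (∗ ∷ [])       ∎)
      where
      open ≋.PermutationReasoning
      padded = λ k → cycles κ ++ replicate k (∗ ∷ [])
    ... | no h≰n = contradiction (begin
      suc (trivialCycles (markedCycleType m u))                           ≡⟨⟩
      trivialCycles ((∗ ∷ []) ∷ markedCycleType m u)
        ≡⟨ trivialCycles-≋ (≋.↭-trans (≋.↭-sym (markedCycleType-fixAt m j u m≤j)) t) ⟩
      trivialCycles (cycles κ ++ replicate (suc n ∸ ∣ κ ∣) (∗ ∷ []))      ≡⟨ trivialCycles-pad (cycles κ) _ proper ⟩
      suc n ∸ ∣ κ ∣                                                       ≡⟨ ℕ.m≤n⇒m∸n≡0 (ℕ.≰⇒> h≰n) ⟩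
      0 ∎) λ ()
      where open ≡-Reasoning

    hasType⇒fixedPoints : ∀ κ → Proper κ → ∀ {n} (u : Permutation′ n) → HasType κ u →
                          length (filter (fixedPoint? m u) (allFin n)) ≡ n ∸ ∣ κ ∣
    hasType⇒fixedPoints κ proper u (_ , t) =
      trans (sym (trivialCycles-type m u)) (trans (trivialCycles-≋ t) (trivialCycles-pad (cycles κ) _ proper))

  -- Extending a permutation by fixed points

  record Extends {r n} (w : Permutation′ r) (π : Permutation′ n) : Set where
    field
      fixes  : ∀ i → r ≤ toℕ i → π ⟨$⟩ʳ i ≡ i
      agrees : ∀ i a → toℕ i ≡ toℕ a → toℕ (π ⟨$⟩ʳ i) ≡ toℕ (w ⟨$⟩ʳ a)
  open Extends

  module _ {r} {w : Permutation′ r} where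

    -- `Extends` is a specification that determines the permutation. So fixed points inserted
    -- anywhere from r onwards give the same result as `extension`, which inserts them at the top,
    -- and no commutation of insertions has to be computed.
    extends-unique : ∀ {n} {π π′ : Permutation′ n} → Extends w π → Extends w π′ → π Perm.≈ π′
    extends-unique e e′ i with toℕ i ℕ.<? r
    ... | no  i≮r = trans (fixes e i (ℕ.≮⇒≥ i≮r)) (sym (fixes e′ i (ℕ.≮⇒≥ i≮r)))
    ... | yes i<r = Fin.toℕ-injective (trans (agrees e i a i≡a) (sym (agrees e′ i a i≡a)))
      where
      a = Fin.fromℕ< i<r
      i≡a = sym (Fin.toℕ-fromℕ< i<r)

    extends-fixAt : ∀ {n} j {π : Permutation′ n} → r ≤ toℕ j → Extends w π → Extends w (fixAt j π)
    extends-fixAt j {π} r≤j e = record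
      { fixes  = punchIn-cases j (λ _ → fixAt-fixes j π) λ i r≤ →
          trans (Perm.insert-punchIn j j π i) (cong (punchIn j) (fixes e i (r≤i i r≤)))
      ; agrees = punchIn-cases j
          (λ a j≡a → contradiction (subst (r ≤_) j≡a r≤j) (ℕ.<⇒≱ (Fin.toℕ<n a)))
          λ i a eq → agrees-punchIn i a eq }
      where
      r≤i : ∀ i → r ≤ toℕ (punchIn j i) → r ≤ toℕ i
      r≤i i r≤ with toℕ i ℕ.<? toℕ j
      ... | yes i<j = subst (r ≤_) (toℕ-punchIn-< j i i<j) r≤
      ... | no  i≮j = ℕ.≤-trans r≤j (ℕ.≮⇒≥ i≮j)

      agrees-punchIn : ∀ i a → toℕ (punchIn j i) ≡ toℕ a →
                       toℕ (fixAt j π ⟨$⟩ʳ punchIn j i) ≡ toℕ (w ⟨$⟩ʳ a)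
      agrees-punchIn i a eq = trans (cong toℕ (Perm.insert-punchIn j j π i))
        (trans (toℕ-punchIn-< j (π ⟨$⟩ʳ i) (ℕ.≤-trans (subst (_< r) (sym πi≡wa) (Fin.toℕ<n _)) r≤j)) πi≡wa)
        where
        i<r : toℕ i < r
        i<r = ℕ.≤-<-trans (≤-toℕ-punchIn j i) (subst (_< r) (sym eq) (Fin.toℕ<n a))
        πi≡wa : toℕ (π ⟨$⟩ʳ i) ≡ toℕ (w ⟨$⟩ʳ a)
        πi≡wa = agrees e i a (trans (sym (toℕ-punchIn-< j i (ℕ.≤-trans i<r r≤j))) eq)

  extension : ∀ {r} → Permutation′ r → ∀ n → r ≤′ n → Permutation′ n
  extension w n       ≤′-refl       = w
  extension w (suc n) (≤′-step r≤n) = fixAt (Fin.fromℕ n) (extension w n r≤n)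

  extension-extends : ∀ {r} (w : Permutation′ r) n r≤n → Extends w (extension w n r≤n)
  extension-extends w n ≤′-refl = record
    { fixes  = λ i r≤i → contradiction r≤i (ℕ.<⇒≱ (Fin.toℕ<n i))
    ; agrees = λ i a i≡a → cong (toℕ ∘ (w ⟨$⟩ʳ_)) (Fin.toℕ-injective i≡a) }
  extension-extends w (suc n) (≤′-step r≤n) = extends-fixAt (Fin.fromℕ n)
    (subst (_ ≤_) (sym (Fin.toℕ-fromℕ n)) (ℕ.≤′⇒≤ r≤n)) (extension-extends w n r≤n)

  -- Both sides are compared after applying `fixAt j u`, where the known forward values of
  -- insertions suffice and the inverse of an insertion need not be computed.
  fixAt-quotient : ∀ {n} j (u π : Permutation′ n) →
                   Perm.flip (fixAt j u) · fixAt j π Perm.≈ fixAt j (Perm.flip u · π)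
  fixAt-quotient j u π i = begin
    u′ ⟨$⟩ˡ (fixAt j π ⟨$⟩ʳ i)
      ≡⟨ cong (u′ ⟨$⟩ˡ_) (punchIn-cases j {λ i → fixAt j π ⟨$⟩ʳ i ≡ u′ ⟨$⟩ʳ (q ⟨$⟩ʳ i)} at-j elsewhere i) ⟩
    u′ ⟨$⟩ˡ (u′ ⟨$⟩ʳ (q ⟨$⟩ʳ i))                   ≡⟨ Perm.inverseˡ u′ ⟩
    q ⟨$⟩ʳ i                                       ∎
    where
    open ≡-Reasoning
    u′ = fixAt j u
    q = fixAt j (Perm.flip u · π)

    at-j : fixAt j π ⟨$⟩ʳ j ≡ u′ ⟨$⟩ʳ (q ⟨$⟩ʳ j)
    at-j = trans (fixAt-fixes j π) (sym (trans (cong (u′ ⟨$⟩ʳ_) (fixAt-fixes j (Perm.flip u · π))) (fixAt-fixes j u)))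

    elsewhere : ∀ i → fixAt j π ⟨$⟩ʳ punchIn j i ≡ u′ ⟨$⟩ʳ (q ⟨$⟩ʳ punchIn j i)
    elsewhere i = begin
      fixAt j π ⟨$⟩ʳ punchIn j i                        ≡⟨ Perm.insert-punchIn j j π i ⟩
      punchIn j (π ⟨$⟩ʳ i)                              ≡⟨ cong (punchIn j) (Perm.inverseʳ u) ⟨
      punchIn j (u ⟨$⟩ʳ (u ⟨$⟩ˡ (π ⟨$⟩ʳ i)))            ≡⟨ Perm.insert-punchIn j j u _ ⟨
      u′ ⟨$⟩ʳ punchIn j (u ⟨$⟩ˡ (π ⟨$⟩ʳ i))             ≡⟨ cong (u′ ⟨$⟩ʳ_) (Perm.insert-punchIn j j (Perm.flip u · π) i) ⟨
      u′ ⟨$⟩ʳ (q ⟨$⟩ʳ punchIn j i)                      ∎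

  length-filter-≥ : ∀ n b → length (filter (λ (i : Fin n) → b ℕ.≤? toℕ i) (allFin n)) ≡ n ∸ b
  length-filter-≥ zero    b    = sym (ℕ.0∸n≡0 b)
  length-filter-≥ (suc n) zero = trans
    (cong length (List.filter-all (λ (i : Fin (suc n)) → 0 ℕ.≤? toℕ i) (All.universal (λ _ → z≤n) (allFin (suc n)))))
    (length-tabulate {n = suc n} (λ i → i))
  length-filter-≥ (suc n) (suc b) = begin
    length (filter P? (tabulate Fin.suc))
      ≡⟨ cong (length ∘ filter P?) (List.map-tabulate {n = n} (λ i → i) Fin.suc) ⟨
    length (filter P? (map Fin.suc (allFin n)))
      ≡⟨ cong length (filter-map P? Fin.suc (allFin n)) ⟩
    length (map Fin.suc (filter (P? ∘ Fin.suc) (allFin n)))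
      ≡⟨ List.length-map Fin.suc (filter (P? ∘ Fin.suc) (allFin n)) ⟩
    length (filter (P? ∘ Fin.suc) (allFin n))
      ≡⟨ cong length (List.filter-≐ (P? ∘ Fin.suc) (λ i → b ℕ.≤? toℕ i) (ℕ.s≤s⁻¹ , s≤s) (allFin n)) ⟩
    length (filter (λ (i : Fin n) → b ℕ.≤? toℕ i) (allFin n))
      ≡⟨ length-filter-≥ n b ⟩
    n ∸ b ∎
    where
    open ≡-Reasoning
    P? : Decidable (λ (i : Fin (suc n)) → suc b ≤ toℕ i)
    P? i = suc b ℕ.≤? toℕ i

  module _ {A : Set} {P Q R E : Pred A 0ℓ}
           (P? : Decidable P) (Q? : Decidable Q) (R? : Decidable R) (E? : Decidable E)
           (P∩Q⊆R : ∀ x → P x → Q x → R x) (E⊆R : ∀ x → E x → R x)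
           (E∩P : ∀ x → E x → ¬ P x) (E∩Q : ∀ x → E x → ¬ Q x) where

    private
      p = length ∘ filter P?
      q = length ∘ filter Q?
      r = length ∘ filter R?
      e = length ∘ filter E?

      ≤-length : ∀ xs {k} → p xs + q xs + (e xs + e xs) ≤ r xs + length xs →
                 k ≡ suc (p xs + q xs + (e xs + e xs)) → k ≤ r xs + suc (length xs)
      ≤-length xs h refl = subst (suc (p xs + q xs + (e xs + e xs)) ≤_) (sym (ℕ.+-suc (r xs) (length xs))) (s≤s h)

      ≤-both : ∀ xs {k} → p xs + q xs + (e xs + e xs) ≤ r xs + length xs →
               k ≡ 2 + (p xs + q xs + (e xs + e xs)) → k ≤ suc (r xs) + suc (length xs)
      ≤-both xs h refl = s≤s (≤-length xs h refl)

    -- Sums the pointwise inequality [P] + [Q] + 2[E] ≤ [R] + 1: a point of E lies in R and in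
    -- neither P nor Q, and a point of both P and Q lies in R.
    length-filter-≤ : ∀ xs → p xs + q xs + (e xs + e xs) ≤ r xs + length xs
    length-filter-≤ []       = z≤n
    length-filter-≤ (x ∷ xs)
      with P? x | Q? x | R? x | E? x | length-filter-≤ xs
    ... | yes Px | _      | _      | yes Ex | _ = contradiction Px (E∩P x Ex)
    ... | no _   | yes Qx | _      | yes Ex | _ = contradiction Qx (E∩Q x Ex)
    ... | no _   | no _   | no ¬Rx | yes Ex | _ = contradiction (E⊆R x Ex) ¬Rx
    ... | yes Px | yes Qx | no ¬Rx | no _   | _ = contradiction (P∩Q⊆R x Px Qx) ¬Rx
    ... | no _   | no _   | yes _  | yes _  | ih = ≤-both xs ih
      (trans (cong (p xs + q xs +_) (cong suc (ℕ.+-suc (e xs) (e xs))))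
        (trans (ℕ.+-suc (p xs + q xs) _) (cong suc (ℕ.+-suc (p xs + q xs) _))))
    ... | yes _  | yes _  | yes _  | no _   | ih = ≤-both xs ih
      (cong (λ k → suc (k + (e xs + e xs))) (ℕ.+-suc (p xs) (q xs)))
    ... | yes _  | no _   | yes _  | no _   | ih = ℕ.m≤n⇒m≤1+n (≤-length xs ih refl)
    ... | yes _  | no _   | no _   | no _   | ih = ≤-length xs ih refl
    ... | no _   | yes _  | yes _  | no _   | ih = ℕ.m≤n⇒m≤1+n
      (≤-length xs ih (cong (_+ (e xs + e xs)) (ℕ.+-suc (p xs) (q xs))))
    ... | no _   | yes _  | no _   | no _   | ih =
      ≤-length xs ih (cong (_+ (e xs + e xs)) (ℕ.+-suc (p xs) (q xs)))
    ... | no _   | no _   | yes _  | no _   | ih = ℕ.m≤n⇒m≤1+n (ℕ.≤-trans (ℕ.n≤1+n _) (≤-length xs ih refl))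
    ... | no _   | no _   | no _   | no _   | ih = ℕ.≤-trans (ℕ.n≤1+n _) (≤-length xs ih refl)

  -- Adding κ + δ + r to the hypothesis absorbs the truncated subtractions; then 2n cancels.
  ∸-sum-≤ : ∀ {n κ δ r e} → κ ≤ n → δ ≤ n → r ≤ n →
            (n ∸ κ) + (n ∸ δ) + (e + e) ≤ (n ∸ r) + n → r + (e + e) ≤ κ + δ
  ∸-sum-≤ {n} {κ} {δ} {r} {e} κ≤ δ≤ r≤ h = ℕ.+-cancelˡ-≤ (n + n) _ _ (begin
    n + n + (r + (e + e))
      ≡⟨ cong₂ (λ x y → x + y + (r + (e + e))) (ℕ.m+[n∸m]≡n κ≤) (ℕ.m+[n∸m]≡n δ≤) ⟨
    (κ + a) + (δ + b) + (r + (e + e))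
      ≡⟨ solve 6 (λ κ a δ b r e → (κ :+ a) :+ (δ :+ b) :+ (r :+ (e :+ e))
                         := (κ :+ δ :+ r) :+ (a :+ b :+ (e :+ e))) refl κ a δ b r e ⟩
    (κ + δ + r) + (a + b + (e + e))
      ≤⟨ ℕ.+-monoʳ-≤ (κ + δ + r) h ⟩
    (κ + δ + r) + (c + n)
      ≡⟨ solve 5 (λ κ δ r c n → (κ :+ δ :+ r) :+ (c :+ n) := ((r :+ c) :+ n) :+ (κ :+ δ)) refl κ δ r c n ⟩
    ((r + c) + n) + (κ + δ)
      ≡⟨ cong (λ x → x + n + (κ + δ)) (ℕ.m+[n∸m]≡n r≤) ⟩
    n + n + (κ + δ) ∎)
    where
    open ℕ.≤-Reasoning
    open ℕSolver
    a = n ∸ κ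
    b = n ∸ δ
    c = n ∸ r

  -- Polynomials and Newton's formula

  -- `fromℕ` normalises its fraction, so its arithmetic is checked on the unnormalised
  -- representative with denominator 1.
  toℚᵘ-fromℕ : ∀ n → ℚ.toℚᵘ (fromℕ n) ℚᵘ.≃ mkℚᵘ (ℤ.+ n) 0
  toℚᵘ-fromℕ n = ℚ.toℚᵘ-fromℚᵘ (mkℚᵘ (ℤ.+ n) 0)

  fromℕ-+ : ∀ a b → fromℕ (a + b) ≡ fromℕ a ℚ.+ fromℕ b
  fromℕ-+ a b = ℚ.toℚᵘ-injective (begin
    ℚ.toℚᵘ (fromℕ (a + b))                   ≈⟨ toℚᵘ-fromℕ (a + b) ⟩
    mkℚᵘ (ℤ.+ (a + b)) 0
      ≈⟨ *≡* (cong (ℤ._* ℤ.+ 1) (cong₂ ℤ._+_ (ℤ.*-identityʳ (ℤ.+ a)) (ℤ.*-identityʳ (ℤ.+ b)))) ⟨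
    mkℚᵘ (ℤ.+ a) 0 ℚᵘ.+ mkℚᵘ (ℤ.+ b) 0           ≈⟨ ℚᵘ.+-cong (toℚᵘ-fromℕ a) (toℚᵘ-fromℕ b) ⟨
    ℚ.toℚᵘ (fromℕ a) ℚᵘ.+ ℚ.toℚᵘ (fromℕ b)   ≈⟨ ℚ.toℚᵘ-homo-+ (fromℕ a) (fromℕ b) ⟨
    ℚ.toℚᵘ (fromℕ a ℚ.+ fromℕ b)             ∎)
    where open ℚᵘ.≃-Reasoning

  fromℕ-* : ∀ a b → fromℕ (a * b) ≡ fromℕ a ℚ.* fromℕ b
  fromℕ-* a b = ℚ.toℚᵘ-injective (begin
    ℚ.toℚᵘ (fromℕ (a * b))                   ≈⟨ toℚᵘ-fromℕ (a * b) ⟩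
    mkℚᵘ (ℤ.+ (a * b)) 0                       ≈⟨ *≡* (cong (ℤ._* ℤ.+ 1) (ℤ.pos-* a b)) ⟩
    mkℚᵘ (ℤ.+ a) 0 ℚᵘ.* mkℚᵘ (ℤ.+ b) 0           ≈⟨ ℚᵘ.*-cong (toℚᵘ-fromℕ a) (toℚᵘ-fromℕ b) ⟨
    ℚ.toℚᵘ (fromℕ a) ℚᵘ.* ℚ.toℚᵘ (fromℕ b)   ≈⟨ ℚ.toℚᵘ-homo-* (fromℕ a) (fromℕ b) ⟨
    ℚ.toℚᵘ (fromℕ a ℚ.* fromℕ b)             ∎)
    where open ℚᵘ.≃-Reasoning

  1/[1+i]*[1+i]≡1 : ∀ i → (ℤ.+ 1 / suc i) ℚ.* fromℕ (suc i) ≡ 1ℚ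
  1/[1+i]*[1+i]≡1 i = ℚ.toℚᵘ-injective (begin
    ℚ.toℚᵘ ((ℤ.+ 1 / suc i) ℚ.* fromℕ (suc i))
      ≈⟨ ℚ.toℚᵘ-homo-* (ℤ.+ 1 / suc i) (fromℕ (suc i)) ⟩
    ℚ.toℚᵘ (ℤ.+ 1 / suc i) ℚᵘ.* ℚ.toℚᵘ (fromℕ (suc i))
      ≈⟨ ℚᵘ.*-cong (ℚ.toℚᵘ-fromℚᵘ (mkℚᵘ (ℤ.+ 1) i)) (toℚᵘ-fromℕ (suc i)) ⟩
    mkℚᵘ (ℤ.+ 1) i ℚᵘ.* mkℚᵘ (ℤ.+ suc i) 0
      ≈⟨ *≡* (cong ℤ.+_ (ℕ.*-assoc 1 (suc i) 1)) ⟩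
    ℚ.toℚᵘ 1ℚ ∎)
    where open ℚᵘ.≃-Reasoning

  infixl 6 _⊕_
  infixr 7 _⊙_

  _⊕_ : Polynomial → Polynomial → Polynomial
  []      ⊕ q       = q
  (a ∷ p) ⊕ []      = a ∷ p
  (a ∷ p) ⊕ (b ∷ q) = a ℚ.+ b ∷ p ⊕ q

  _⊙_ : ℚ → Polynomial → Polynomial
  c ⊙ p = map (c ℚ.*_) p

  length-⊕ : ∀ p q {ℓ} → length p ≤ ℓ → length q ≤ ℓ → length (p ⊕ q) ≤ ℓ
  length-⊕ []      q       h       k       = k
  length-⊕ (a ∷ p) []      h       k       = h
  length-⊕ (a ∷ p) (b ∷ q) (s≤s h) (s≤s k) = s≤s (length-⊕ p q h k)

  eval-⊕ : ∀ p q x → eval (p ⊕ q) x ≡ eval p x ℚ.+ eval q x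
  eval-⊕ []      q       x = sym (ℚ.+-identityˡ (eval q x))
  eval-⊕ (a ∷ p) []      x = sym (ℚ.+-identityʳ (eval (a ∷ p) x))
  eval-⊕ (a ∷ p) (b ∷ q) x rewrite eval-⊕ p q x =
    solve 5 (λ a b x y z → (a :+ b) :+ x :* (y :+ z) := (a :+ x :* y) :+ (b :+ x :* z))
      refl a b x (eval p x) (eval q x)
    where open ℚSolver

  eval-⊙ : ∀ c p x → eval (c ⊙ p) x ≡ c ℚ.* eval p x
  eval-⊙ c []      x = sym (ℚ.*-zeroʳ c)
  eval-⊙ c (a ∷ p) x rewrite eval-⊙ c p x =
    solve 4 (λ c a x y → c :* a :+ x :* (c :* y) := c :* (a :+ x :* y)) refl c a x (eval p x)
    where open ℚSolver

  -- Only an upper bound on the degree is wanted, so the construction tracks lengths of coefficient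
  -- lists and never has to decide whether a leading coefficient cancels.
  deg<length : ∀ p {d} → deg p ≡ just d → d < length p
  deg<length (a ∷ p) eq with deg p in degp | a ℚ.≟ 0ℚ
  deg<length (a ∷ p) refl | just d  | _    = s<s (deg<length p degp)
  deg<length (a ∷ p) refl | nothing | no _ = z<s

  -- The absorption identity (i + 1) C(k, i + 1) = (k - i) C(k, i), rearranged to avoid subtraction;
  -- Pascal's rule reduces k + 1 to k.
  [1+i]*kC[1+i]+i*kCi≡k*kCi : ∀ k i → suc i * (k C suc i) + i * (k C i) ≡ k * (k C i)
  [1+i]*kC[1+i]+i*kCi≡k*kCi k zero
    rewrite nC1≡n k = trans (ℕ.+-identityʳ (k + 0)) (trans (ℕ.+-identityʳ k) (sym (ℕ.*-identityʳ k)))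
  [1+i]*kC[1+i]+i*kCi≡k*kCi zero (suc i)
    rewrite k>n⇒nCk≡0 {0} {suc i} z<s | k>n⇒nCk≡0 {0} {suc (suc i)} z<s
    = cong₂ _+_ (ℕ.*-zeroʳ (suc (suc i))) (ℕ.*-zeroʳ (suc i))
  [1+i]*kC[1+i]+i*kCi≡k*kCi (suc k) (suc i)
    rewrite sym (nCk+nC[k+1]≡[n+1]C[k+1] k (suc i)) | sym (nCk+nC[k+1]≡[n+1]C[k+1] k i)
    = begin
    (2 + i) * (b + c) + (1 + i) * (a + b)
      ≡⟨ solve 4 (λ i a b c → (con 2 :+ i) :* (b :+ c) :+ (con 1 :+ i) :* (a :+ b)
            := ((con 2 :+ i) :* c :+ (con 1 :+ i) :* b)
               :+ ((con 1 :+ i) :* b :+ i :* a) :+ (a :+ b)) refl i a b c ⟩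
    ((2 + i) * c + (1 + i) * b) + ((1 + i) * b + i * a) + (a + b)
      ≡⟨ cong₂ (λ y z → y + z + (a + b))
           ([1+i]*kC[1+i]+i*kCi≡k*kCi k (suc i)) ([1+i]*kC[1+i]+i*kCi≡k*kCi k i) ⟩
    k * b + k * a + (a + b)
      ≡⟨ solve 3 (λ k a b → k :* b :+ k :* a :+ (a :+ b) := (con 1 :+ k) :* (a :+ b)) refl k a b ⟩
    (1 + k) * (a + b) ∎
    where
    open ≡-Reasoning
    open ℕSolver
    a = k C i
    b = k C suc i
    c = k C suc (suc i)

  -- The argument of the polynomial is r + k, not k.
  IsPolynomial : ℕ → ℕ → (ℕ → ℕ) → Set
  IsPolynomial r ℓ f =
    ∃ λ p → length p ≤ ℓ × ∀ k → fromℕ (f k) ≡ eval p (fromℕ (r + k))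

  binomial-isPolynomial : ∀ r i → IsPolynomial r (suc i) (_C i)
  binomial-isPolynomial r zero    = 1ℚ ∷ [] , s≤s z≤n , λ k →
    sym (trans (cong (1ℚ ℚ.+_) (ℚ.*-zeroʳ (fromℕ (r + k)))) refl)
  binomial-isPolynomial r (suc i) with p , len , eq ← binomial-isPolynomial r i =
    -- By the absorption identity the next binomial arises on multiplying by (k - i) / (i + 1). In
    -- the variable x = r + k this is (x - (r + i)) / (i + 1), and `0ℚ ∷ p` is x times `p`.
    q ⊙ ((ℚ.- fromℕ (r + i)) ⊙ p ⊕ (0ℚ ∷ p)) , length-≤ , λ k → sym (evaluate k)
    where
    q = ℤ.+ 1 / suc i
    length-≤ : length (q ⊙ ((ℚ.- fromℕ (r + i)) ⊙ p ⊕ (0ℚ ∷ p))) ≤ suc (suc i)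
    length-≤ = subst (_≤ suc (suc i)) (sym (length-map _ ((ℚ.- fromℕ (r + i)) ⊙ p ⊕ (0ℚ ∷ p))))
      (length-⊕ ((ℚ.- fromℕ (r + i)) ⊙ p) (0ℚ ∷ p)
        (subst (_≤ suc (suc i)) (sym (length-map _ p)) (ℕ.m≤n⇒m≤1+n len)) (s≤s len))
    evaluate : ∀ k → eval (q ⊙ ((ℚ.- fromℕ (r + i)) ⊙ p ⊕ (0ℚ ∷ p))) (fromℕ (r + k)) ≡ fromℕ (k C suc i)
    evaluate k = begin
      eval (q ⊙ ((ℚ.- fromℕ (r + i)) ⊙ p ⊕ (0ℚ ∷ p))) x
        ≡⟨ eval-⊙ q ((ℚ.- fromℕ (r + i)) ⊙ p ⊕ (0ℚ ∷ p)) x ⟩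
      q ℚ.* eval ((ℚ.- fromℕ (r + i)) ⊙ p ⊕ (0ℚ ∷ p)) x
        ≡⟨ cong (q ℚ.*_) (eval-⊕ ((ℚ.- fromℕ (r + i)) ⊙ p) (0ℚ ∷ p) x) ⟩
      q ℚ.* (eval ((ℚ.- fromℕ (r + i)) ⊙ p) x ℚ.+ (0ℚ ℚ.+ x ℚ.* eval p x))
        ≡⟨ cong (λ y → q ℚ.* (y ℚ.+ (0ℚ ℚ.+ x ℚ.* eval p x))) (eval-⊙ (ℚ.- fromℕ (r + i)) p x) ⟩
      q ℚ.* ((ℚ.- fromℕ (r + i)) ℚ.* eval p x ℚ.+ (0ℚ ℚ.+ x ℚ.* eval p x))
        ≡⟨ cong (λ y → q ℚ.* ((ℚ.- fromℕ (r + i)) ℚ.* y ℚ.+ (0ℚ ℚ.+ x ℚ.* y))) (sym (eq k)) ⟩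
      q ℚ.* ((ℚ.- fromℕ (r + i)) ℚ.* b ℚ.+ (0ℚ ℚ.+ x ℚ.* b))
        ≡⟨ cong₂ (λ y z → q ℚ.* ((ℚ.- y) ℚ.* b ℚ.+ (0ℚ ℚ.+ z ℚ.* b))) (fromℕ-+ r i) (fromℕ-+ r k) ⟩
      q ℚ.* ((ℚ.- (R ℚ.+ I)) ℚ.* b ℚ.+ (0ℚ ℚ.+ (R ℚ.+ K′) ℚ.* b))
        ≡⟨ solve 5 (λ q R I K b → q :* ((:- (R :+ I)) :* b :+ (con 0ℚ :+ (R :+ K) :* b))
                      := q :* (K :* b :+ (:- (I :* b)))) refl q R I K′ b ⟩
      q ℚ.* (K′ ℚ.* b ℚ.+ (ℚ.- (I ℚ.* b)))
        ≡⟨ cong (λ y → q ℚ.* (y ℚ.+ (ℚ.- (I ℚ.* b)))) recurrence ⟨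
      q ℚ.* ((S ℚ.* c ℚ.+ I ℚ.* b) ℚ.+ (ℚ.- (I ℚ.* b)))
        ≡⟨ solve 4 (λ q s c y → q :* ((s :* c :+ y) :+ (:- y)) := (q :* s) :* c) refl q S c (I ℚ.* b) ⟩
      (q ℚ.* S) ℚ.* c
        ≡⟨ cong (ℚ._* c) (1/[1+i]*[1+i]≡1 i) ⟩
      1ℚ ℚ.* c
        ≡⟨ ℚ.*-identityˡ c ⟩
      c ∎
      where
      open ≡-Reasoning
      open ℚSolver
      x = fromℕ (r + k)
      R = fromℕ r
      I = fromℕ i
      K′ = fromℕ k
      S = fromℕ (suc i)
      b = fromℕ (k C i)
      c = fromℕ (k C suc i)
      recurrence : S ℚ.* c ℚ.+ I ℚ.* b ≡ K′ ℚ.* b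
      recurrence = begin
        S ℚ.* c ℚ.+ I ℚ.* b
          ≡⟨ cong₂ ℚ._+_ (fromℕ-* (suc i) (k C suc i)) (fromℕ-* i (k C i)) ⟨
        fromℕ (suc i * (k C suc i)) ℚ.+ fromℕ (i * (k C i))
          ≡⟨ fromℕ-+ (suc i * (k C suc i)) (i * (k C i)) ⟨
        fromℕ (suc i * (k C suc i) + i * (k C i))
          ≡⟨ cong fromℕ ([1+i]*kC[1+i]+i*kCi≡k*kCi k i) ⟩
        fromℕ (k * (k C i))
          ≡⟨ fromℕ-* k (k C i) ⟩
        K′ ℚ.* b ∎

  -- The Newton series a₀ C(k, i) + a₁ C(k, i + 1) + .... Raising the offset i by one sums the
  -- series over k, as `newton-suc` and `newton-zero` express.
  newton : List ℕ → ℕ → ℕ → ℕ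
  newton []       i k = 0
  newton (a ∷ as) i k = a * (k C i) + newton as (suc i) k

  newton-suc : ∀ as i k → newton as (suc i) (suc k) ≡ newton as i k + newton as (suc i) k
  newton-suc []       i k = refl
  newton-suc (a ∷ as) i k
    rewrite sym (nCk+nC[k+1]≡[n+1]C[k+1] k i) | newton-suc as (suc i) k =
    solve 5 (λ a y z v w → a :* (y :+ z) :+ (v :+ w) := (a :* y :+ v) :+ (a :* z :+ w)) refl
      a (k C i) (k C suc i) (newton as (suc i) k) (newton as (suc (suc i)) k)
    where open ℕSolver

  newton-zero : ∀ as i → newton as (suc i) 0 ≡ 0
  newton-zero []       i = refl
  newton-zero (a ∷ as) i = cong₂ _+_
    (trans (cong (a *_) (k>n⇒nCk≡0 {0} {suc i} z<s)) (ℕ.*-zeroʳ a)) (newton-zero as (suc i))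

  newton-isPolynomial : ∀ r as i → IsPolynomial r (i + length as) (newton as i)
  newton-isPolynomial r []       i = [] , z≤n , λ k → refl
  newton-isPolynomial r (a ∷ as) i
    with p , p≤ , p-eq ← binomial-isPolynomial r i
       | q , q≤ , q-eq ← newton-isPolynomial r as (suc i) =
    fromℕ a ⊙ p ⊕ q
    , length-⊕ (fromℕ a ⊙ p) q
        (subst (_≤ i + suc (length as)) (sym (length-map _ p))
          (ℕ.≤-trans p≤ (ℕ.≤-trans (s≤s (ℕ.m≤m+n i (length as))) (ℕ.≤-reflexive (sym (ℕ.+-suc i _))))))
        (subst (length q ≤_) (sym (ℕ.+-suc i _)) q≤)
    , λ k → sym (evaluate k)
    where
    open ≡-Reasoning
    evaluate : ∀ k → eval (fromℕ a ⊙ p ⊕ q) (fromℕ (r + k)) ≡ fromℕ (newton (a ∷ as) i k)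
    evaluate k = begin
      eval (fromℕ a ⊙ p ⊕ q) x
        ≡⟨ eval-⊕ (fromℕ a ⊙ p) q x ⟩
      eval (fromℕ a ⊙ p) x ℚ.+ eval q x
        ≡⟨ cong₂ ℚ._+_ (eval-⊙ (fromℕ a) p x) (sym (q-eq k)) ⟩
      fromℕ a ℚ.* eval p x ℚ.+ fromℕ (newton as (suc i) k)
        ≡⟨ cong (λ y → fromℕ a ℚ.* y ℚ.+ fromℕ (newton as (suc i) k)) (p-eq k) ⟨
      fromℕ a ℚ.* fromℕ (k C i) ℚ.+ fromℕ (newton as (suc i) k)
        ≡⟨ cong (ℚ._+ fromℕ (newton as (suc i) k)) (fromℕ-* a (k C i)) ⟨
      fromℕ (a * (k C i)) ℚ.+ fromℕ (newton as (suc i) k)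
        ≡⟨ fromℕ-+ (a * (k C i)) (newton as (suc i) k) ⟨
      fromℕ (a * (k C i) + newton as (suc i) k) ∎
      where x = fromℕ (r + k)

  -- Newton's forward difference formula: row e + 1 of g lists the differences of row e.
  newton-expansion : ∀ L (g : ℕ → ℕ → ℕ) →
                     (∀ e k → g e (suc k) ≡ g e k + g (suc e) k) →
                     (∀ e k → L ≤ e → g e k ≡ 0) →
                     ∃ λ as → length as ≡ L × ∀ k → g 0 k ≡ newton as 0 k
  newton-expansion zero    g step vanish = [] , refl , λ k → vanish 0 k z≤n
  newton-expansion (suc L) g step vanish
    with as , len , eq ← newton-expansion L (g ∘ suc) (step ∘ suc) (λ e k → vanish (suc e) k ∘ s≤s) =
    -- The table without row 0 expands its first row, which is the difference of row 0. Summing that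
    -- expansion shifts every lower index by one, and `g 0 0` is the constant of summation.
    g 0 0 ∷ as , cong suc len , expand
    where
    open ≡-Reasoning
    expand : ∀ k → g 0 k ≡ g 0 0 * 1 + newton as 1 k
    expand zero    = sym (trans (cong₂ _+_ (ℕ.*-identityʳ (g 0 0)) (newton-zero as 0)) (ℕ.+-identityʳ _))
    expand (suc k) = begin
      g 0 (suc k)                                       ≡⟨ step 0 k ⟩
      g 0 k + g 1 k                                     ≡⟨ cong₂ _+_ (expand k) (eq k) ⟩
      g 0 0 * 1 + newton as 1 k + newton as 0 k         ≡⟨ ℕ.+-assoc (g 0 0 * 1) _ _ ⟩
      g 0 0 * 1 + (newton as 1 k + newton as 0 k)       ≡⟨ cong ((g 0 0 * 1) +_) (ℕ.+-comm (newton as 1 k) _) ⟩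
      g 0 0 * 1 + (newton as 0 k + newton as 1 k)       ≡⟨ cong ((g 0 0 * 1) +_) (newton-suc as 0 k) ⟨
      g 0 0 * 1 + newton as 1 (suc k)                   ∎

  difference-table-isPolynomial : ∀ r L (g : ℕ → ℕ → ℕ) →
    (∀ e k → g e (suc k) ≡ g e k + g (suc e) k) → (∀ e k → L ≤ e → g e k ≡ 0) →
    IsPolynomial r L (g 0)
  difference-table-isPolynomial r L g step vanish
    with as , len , eq ← newton-expansion L g step vanish
    with p , p≤ , p-eq ← newton-isPolynomial r as 0 =
    p , subst (length p ≤_) len p≤ , λ k → trans (cong fromℕ (eq k)) (p-eq k)

  -- Row e of the table holds F along the line n - b = e, indexed by k = b - r. The recurrence makes
  -- row e + 1 the difference of row e, rows from L onwards vanish, and row 0 is the diagonal F(n,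
  -- n).
  pascal-isPolynomial : ∀ r L (F : ∀ n b → r ≤ n → ℕ) →
    (∀ n b r≤n r≤1+n → r ≤ b → b ≤ n → F (suc n) (suc b) r≤1+n ≡ F n b r≤n + F (suc n) b r≤1+n) →
    (∀ n b r≤n → r ≤ b → L ≤ n ∸ b → F n b r≤n ≡ 0) →
    ∃ λ p → length p ≤ L × ∀ n r≤n → fromℕ (F n n r≤n) ≡ eval p (fromℕ n)
  pascal-isPolynomial r L F step vanish =
    proj₁ row₀ , proj₁ (proj₂ row₀) , λ n r≤n → at (ℕ.m≤n⇒∃[o]m+o≡n r≤n) r≤n
    where
    table : ℕ → ℕ → ℕ
    table e k = F (k + e + r) (k + r) (ℕ.m≤n+m r (k + e))

    F-cong : ∀ {n n′ b b′} r≤n r≤n′ → n ≡ n′ → b ≡ b′ → F n b r≤n ≡ F n′ b′ r≤n′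
    F-cong r≤n r≤n′ refl refl = cong (F _ _) (ℕ.≤-irrelevant r≤n r≤n′)

    difference : ∀ k e → k + e + r ∸ (k + r) ≡ e
    difference k e = trans (cong (_∸ (k + r)) (solve 3 (λ k e r → k :+ e :+ r := k :+ r :+ e) refl k e r))
                           (ℕ.m+n∸m≡n (k + r) e)
      where open ℕSolver

    row₀ : IsPolynomial r L (table 0)
    row₀ = difference-table-isPolynomial r L table
      (λ e k → trans
        (step (k + e + r) (k + r) _ _ (ℕ.m≤n+m r k) (ℕ.+-monoˡ-≤ r (ℕ.m≤m+n k e)))
        (cong (table e k +_) (F-cong _ _ (cong (_+ r) (sym (ℕ.+-suc k e))) refl)))
      (λ e k L≤e → vanish (k + e + r) (k + r) _ (ℕ.m≤n+m r k) (subst (L ≤_) (sym (difference k e)) L≤e))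

    at : ∀ {n} → ∃ (λ k → r + k ≡ n) → ∀ r≤n → fromℕ (F n n r≤n) ≡ eval (proj₁ row₀) (fromℕ n)
    at (k , refl) r≤n = trans (cong fromℕ diagonal) (proj₂ (proj₂ row₀) k)
      where
      diagonal : F (r + k) (r + k) r≤n ≡ table 0 k
      diagonal = F-cong r≤n (ℕ.m≤n+m r (k + 0))
        (trans (ℕ.+-comm r k) (cong (_+ r) (sym (ℕ.+-identityʳ k)))) (ℕ.+-comm r k)

  -- Factorisations of a permutation

  extension-hasType : ∀ {m} (ρ : Shape m) (w : Permutation′ ∣ ρ ∣) → markedCycleType m w ≋ cycles ρ →
                      ∀ n (ρ≤n : ∣ ρ ∣ ≤′ n) → HasType ρ (extension w n ρ≤n)
  extension-hasType ρ w t n ≤′-refl = ℕ.≤-refl , ≋.↭-trans t (≋.↭-reflexive (sym (trans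
    (cong (λ k → cycles ρ ++ replicate k (∗ ∷ [])) (ℕ.n∸n≡0 n)) (List.++-identityʳ (cycles ρ)))))
  extension-hasType ρ w t (suc n) (≤′-step ρ≤n) =
    hasType-fixAt⁺ ρ (Fin.fromℕ n) (extension w n ρ≤n)
      (subst (_ ≤_) (sym (Fin.toℕ-fromℕ n)) (ℕ.≤-trans (ℕ.m≤m+n _ _) (ℕ.≤′⇒≤ ρ≤n)))
      (extension-hasType ρ w t n ρ≤n)

  flip-cong : ∀ {n} (π : Permutation′ n) {u v : Permutation′ n} → u Perm.≈ v → Perm.flip u · π Perm.≈ Perm.flip v · π
  flip-cong π {u} {v} u≈v i = begin
    u ⟨$⟩ˡ (π ⟨$⟩ʳ i)                      ≡⟨ cong (u ⟨$⟩ˡ_) (Perm.inverseʳ v) ⟨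
    u ⟨$⟩ˡ (v ⟨$⟩ʳ (v ⟨$⟩ˡ (π ⟨$⟩ʳ i)))    ≡⟨ cong (u ⟨$⟩ˡ_) (u≈v _) ⟨
    u ⟨$⟩ˡ (u ⟨$⟩ʳ (v ⟨$⟩ˡ (π ⟨$⟩ʳ i)))    ≡⟨ Perm.inverseˡ u ⟩
    v ⟨$⟩ˡ (π ⟨$⟩ʳ i)                      ∎
    where open ≡-Reasoning

  module _ {m} (κ δ ρ : Shape m) (w : Permutation′ ∣ ρ ∣) where

    target : ∀ n → ∣ ρ ∣ ≤ n → Permutation′ n
    target n ρ≤n = extension w n (ℕ.≤⇒≤′ ρ≤n)

    -- `u` and `Perm.flip u · π` are the two factors of `π`. For b = n the last condition is empty.
    Factor : ∀ {n} → Permutation′ n → ℕ → Permutation′ n → Set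
    Factor π b u = HasType κ u × HasType δ (Perm.flip u · π) × (∀ i → b ≤ toℕ i → u ⟨$⟩ʳ i ≢ i)

    factor? : ∀ {n} (π : Permutation′ n) b → Decidable (Factor π b)
    factor? π b u = hasType? κ u ×-dec (hasType? δ (Perm.flip u · π) ×-dec
      Fin.all? (λ i → (b ℕ.≤? toℕ i) →-dec ¬? (u ⟨$⟩ʳ i Fin.≟ i)))

    factor-resp : ∀ {n} (π : Permutation′ n) b → Factor π b Respects Perm._≈_
    factor-resp π b {u} {v} u≈v (κu , δv , moves) =
      hasType-resp κ {u = u} {v} u≈v κu
      , hasType-resp δ {u = Perm.flip u · π} {Perm.flip v · π} (flip-cong π {u} {v} u≈v) δv
      , λ i b≤i vi≡i → moves i b≤i (trans (u≈v i) vi≡i)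

    factors : ∀ n b → ∣ ρ ∣ ≤ n → ℕ
    factors n b ρ≤n = count (factor? (target n ρ≤n) b)

    module _ (κ-proper : Proper κ) (δ-proper : Proper δ) where

      -- The count is split by whether `u` fixes the point of index b. If it does, deleting that
      -- point lowers the later ones by one, so the points to be moved start at b again; if not, b
      -- joins them. Because |ρ| ≤ b, the point is unmarked and fixed by the target.
      factors-step : ∀ n b (ρ≤n : ∣ ρ ∣ ≤ n) (ρ≤1+n : ∣ ρ ∣ ≤ suc n) → ∣ ρ ∣ ≤ b → b ≤ n →
                     factors (suc n) (suc b) ρ≤1+n ≡ factors n b ρ≤n + factors (suc n) b ρ≤1+n
      factors-step n b ρ≤n ρ≤1+n ρ≤b b≤n = begin
        factors (suc n) (suc b) ρ≤1+n
          ≡⟨ count-split (factor? π′ (suc b)) fixed? ⟩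
        count (λ u → fixed? u ×-dec factor? π′ (suc b) u) +
        count (λ u → ¬? (fixed? u) ×-dec factor? π′ (suc b) u)
          ≡⟨ cong₂ _+_ (count-fixing j (factor? π′ (suc b)) (λ {u} {v} → factor-resp π′ (suc b) {u} {v}))
                       (count-cong (λ u → ¬? (fixed? u) ×-dec factor? π′ (suc b) u) (factor? π′ b) moving⁺ moving⁻) ⟩
        count (λ u → factor? π′ (suc b) (fixAt j u)) + factors (suc n) b ρ≤1+n
          ≡⟨ cong (_+ factors (suc n) b ρ≤1+n)
               (count-cong (λ u → factor? π′ (suc b) (fixAt j u)) (factor? π b) fixing⁺ fixing⁻) ⟩
        factors n b ρ≤n + factors (suc n) b ρ≤1+n ∎
        where
        open ≡-Reasoning
        π = target n ρ≤n
        π′ = target (suc n) ρ≤1+n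
        j = Fin.fromℕ< (s≤s b≤n)

        fixed? : Decidable (λ (u : Permutation′ (suc n)) → u ⟨$⟩ʳ j ≡ j)
        fixed? u = u ⟨$⟩ʳ j Fin.≟ j

        j≡b : toℕ j ≡ b
        j≡b = Fin.toℕ-fromℕ< (s≤s b≤n)

        ρ≤j : ∣ ρ ∣ ≤ toℕ j
        ρ≤j = subst (∣ ρ ∣ ≤_) (sym j≡b) ρ≤b

        m≤j : m ≤ toℕ j
        m≤j = ℕ.≤-trans (ℕ.m≤m+n m _) ρ≤j

        -- The larger target has its new fixed point at the top, while the deletion takes place at
        -- `j`; both permutations extend `w`.
        π′≈ : π′ Perm.≈ fixAt j π
        π′≈ = extends-unique {π = π′} {fixAt j π} (extension-extends w (suc n) (ℕ.≤⇒≤′ ρ≤1+n))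
                (extends-fixAt j ρ≤j (extension-extends w n (ℕ.≤⇒≤′ ρ≤n)))

        quotient≈ : ∀ u → Perm.flip (fixAt j u) · π′ Perm.≈ fixAt j (Perm.flip u · π)
        quotient≈ u i = trans (cong (fixAt j u ⟨$⟩ˡ_) (π′≈ i)) (fixAt-quotient j u π i)

        quotient⁺ : ∀ u → HasType δ (Perm.flip u · π) → HasType δ (Perm.flip (fixAt j u) · π′)
        quotient⁺ u t = hasType-resp δ {u = fixAt j (Perm.flip u · π)} {Perm.flip (fixAt j u) · π′}
          (λ i → sym (quotient≈ u i)) (hasType-fixAt⁺ δ j (Perm.flip u · π) m≤j t)

        quotient⁻ : ∀ u → HasType δ (Perm.flip (fixAt j u) · π′) → HasType δ (Perm.flip u · π)
        quotient⁻ u t = hasType-fixAt⁻ δ δ-proper j (Perm.flip u · π) m≤j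
          (hasType-resp δ {u = Perm.flip (fixAt j u) · π′} {fixAt j (Perm.flip u · π)} (quotient≈ u) t)

        fixing⁺ : ∀ u → Factor π′ (suc b) (fixAt j u) → Factor π b u
        fixing⁺ u (κu , δv , moves) = hasType-fixAt⁻ κ κ-proper j u m≤j κu , quotient⁻ u δv ,
          λ i b≤i ui≡i → moves (punchIn j i)
            (subst (suc b ≤_) (sym (toℕ-punchIn-≥ j i (subst (_≤ toℕ i) (sym j≡b) b≤i))) (s≤s b≤i))
            (trans (Perm.insert-punchIn j j u i) (cong (punchIn j) ui≡i))

        fixing⁻ : ∀ u → Factor π b u → Factor π′ (suc b) (fixAt j u)
        fixing⁻ u (κu , δv , moves) = hasType-fixAt⁺ κ j u m≤j κu , quotient⁺ u δv , punchIn-cases j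
          (λ b<j → contradiction (subst (suc b ≤_) j≡b b<j) (ℕ.<-irrefl refl))
          λ i b<i ui≡i → moves i (above i b<i)
            (Fin.punchIn-injective j _ _ (trans (sym (Perm.insert-punchIn j j u i)) ui≡i))
          where
          above : ∀ i → suc b ≤ toℕ (punchIn j i) → b ≤ toℕ i
          above i b<i with toℕ i ℕ.<? toℕ j
          ... | no i≮j  = subst (_≤ toℕ i) j≡b (ℕ.≮⇒≥ i≮j)
          ... | yes i<j = ℕ.<⇒≤ (subst (suc b ≤_) (toℕ-punchIn-< j i i<j) b<i)

        moving⁺ : ∀ u → u ⟨$⟩ʳ j ≢ j × Factor π′ (suc b) u → Factor π′ b u
        moving⁺ u (uj≢j , κu , δv , moves) = κu , δv , all
          where
          all : ∀ i → b ≤ toℕ i → u ⟨$⟩ʳ i ≢ i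
          all i b≤i with b ℕ.≟ toℕ i
          ... | no  b≢i = moves i (ℕ.≤∧≢⇒< b≤i b≢i)
          ... | yes b≡i = subst (λ i → u ⟨$⟩ʳ i ≢ i) (Fin.toℕ-injective (trans j≡b b≡i)) uj≢j

        moving⁻ : ∀ u → Factor π′ b u → u ⟨$⟩ʳ j ≢ j × Factor π′ (suc b) u
        moving⁻ u (κu , δv , moves) = moves j (ℕ.≤-reflexive (sym j≡b))
                                    , κu , δv , λ i b<i → moves i (ℕ.<⇒≤ b<i)

      module _ (ρ-proper : Proper ρ) (w-type : markedCycleType m w ≋ cycles ρ) where

        -- A moved point that the target fixes is moved by both factors.
        factors-vanish : ∀ n b ρ≤n → ∣ ρ ∣ ≤ b → ∣ κ ∣ + ∣ δ ∣ < ∣ ρ ∣ + ((n ∸ b) + (n ∸ b)) →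
                         factors n b ρ≤n ≡ 0
        factors-vanish n b ρ≤n ρ≤b large = count-none (factor? π b) λ u factor →
          contradiction (bound u factor) (ℕ.<⇒≱ large)
          where
          π = target n ρ≤n

          bound : ∀ u → Factor π b u → ∣ ρ ∣ + ((n ∸ b) + (n ∸ b)) ≤ ∣ κ ∣ + ∣ δ ∣
          bound u (κu , δv , moves) = ∸-sum-≤ {e = n ∸ b} (proj₁ κu) (proj₁ δv) ρ≤n (subst₂ _≤_
            (cong₂ _+_
              (cong₂ _+_ (hasType⇒fixedPoints κ κ-proper u κu) (hasType⇒fixedPoints δ δ-proper v δv))
              (cong₂ _+_ (length-filter-≥ n b) (length-filter-≥ n b)))
            (cong₂ _+_ (hasType⇒fixedPoints ρ ρ-proper π (extension-hasType ρ w w-type n (ℕ.≤⇒≤′ ρ≤n)))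
                       (length-tabulate {n = n} (λ i → i)))
            (length-filter-≤ (fixedPoint? m u) (fixedPoint? m v) (fixedPoint? m π) (λ i → b ℕ.≤? toℕ i)
              both (λ i b≤i → ℕ.≤-trans (ℕ.m≤m+n m _) (ℕ.≤-trans ρ≤b b≤i) , π-fixes i b≤i)
              (λ i b≤i (_ , ui≡i) → moves i b≤i ui≡i)
              -- Here π(i) = i, so v(i) = i means u⁻¹(i) = i, hence u(i) = i, which `moves`
              -- excludes.
              (λ i b≤i (_ , vi≡i) → moves i b≤i (trans
                (cong (u ⟨$⟩ʳ_) (sym (trans (cong (u ⟨$⟩ˡ_) (sym (π-fixes i b≤i))) vi≡i)))
                                                   (Perm.inverseʳ u)))
              (allFin n)))
            where
            v = Perm.flip u · π

            π-fixes : ∀ i → b ≤ toℕ i → π ⟨$⟩ʳ i ≡ i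
            π-fixes i b≤i = fixes (extension-extends w n (ℕ.≤⇒≤′ ρ≤n)) i (ℕ.≤-trans ρ≤b b≤i)

            both : ∀ i → FixedPoint m u i → FixedPoint m v i → FixedPoint m π i
            both i (m≤i , ui≡i) (_ , vi≡i) = m≤i , trans (sym (Perm.inverseʳ u)) (trans (cong (u ⟨$⟩ʳ_) vi≡i) ui≡i)

        factors-isPolynomial : ∀ L → (∀ e → L ≤ e → ∣ κ ∣ + ∣ δ ∣ < ∣ ρ ∣ + (e + e)) →
          ∃ λ p → length p ≤ L × (∀ n ρ≤n → fromℕ (factors n n ρ≤n) ≡ eval p (fromℕ n))
        factors-isPolynomial L large = pascal-isPolynomial (∣ ρ ∣) L factors factors-step
          λ n b ρ≤n ρ≤b L≤n∸b → factors-vanish n b ρ≤n ρ≤b (large (n ∸ b) L≤n∸b)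

  -- Structure coefficients

  ∑-zero : ∀ {A : Set} (xs : List A) {f} → All (λ y → f y ≡ 0ℤ) xs → ∑ xs f ≡ 0ℤ
  ∑-zero []       []       = refl
  ∑-zero (x ∷ xs) (e ∷ es) = cong₂ ℤ._+_ e (∑-zero xs es)

  module _ (S : Setoid 0ℓ 0ℓ) where
    open Setoid S using (Carrier; _≈_) renaming (sym to ≈-sym; trans to ≈-trans)
    open Membership S using () renaming (_∈_ to _∈ˢ_)

    ∑-unique : ∀ {xs x f c} → UniqueS.Unique S xs → x ∈ˢ xs → (∀ {y} → x ≈ y → f y ≡ c) →
               (∀ {y} → ¬ x ≈ y → f y ≡ 0ℤ) → ∑ xs f ≡ c
    ∑-unique {y ∷ ys} (y≉ ∷ _) (here x≈y) eq≈ eq≉ = trans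
      (cong₂ ℤ._+_ (eq≈ x≈y) (∑-zero ys (All.map (λ y≉z → eq≉ (y≉z ∘ ≈-trans (≈-sym x≈y))) y≉)))
      (ℤ.+-identityʳ _)
    ∑-unique {y ∷ ys} (y≉ ∷ ys!) (there x∈ys) eq≈ eq≉ = trans
      (cong₂ ℤ._+_ (eq≉ (λ x≈y → All.All¬⇒¬Any y≉ (Membershipₚ.∈-resp-≈ S x≈y x∈ys)))
                   (∑-unique ys! x∈ys eq≈ eq≉))
      (ℤ.+-identityˡ _)

  ∑-indicator : ∀ {A : Set} {P Q : Pred A 0ℓ} (P? : Decidable P) (Q? : Decidable Q) xs →
    ∑ xs (λ x → (if does (P? x) then 1ℤ else 0ℤ) ℤ.* (if does (Q? x) then 1ℤ else 0ℤ))
    ≡ ℤ.+ length (filter (λ x → P? x ×-dec Q? x) xs)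
  ∑-indicator P? Q? []       = refl
  ∑-indicator P? Q? (x ∷ xs) with P? x | Q? x
  ... | yes _ | yes _ = cong ℤ.suc (∑-indicator P? Q? xs)
  ... | yes _ | no  _ = trans (ℤ.+-identityˡ _) (∑-indicator P? Q? xs)
  ... | no  _ | yes _ = trans (ℤ.+-identityˡ _) (∑-indicator P? Q? xs)
  ... | no  _ | no  _ = trans (ℤ.+-identityˡ _) (∑-indicator P? Q? xs)

  -- At a permutation of type `ρ` only one term of the expansion survives, because `shapes` presents
  -- each shape exactly once. That presentation may differ from `ρ`, which `coeff-cong` makes up
  -- for.
  coeff≡product : ∀ {m n} (c : StructureCoefficients m n) κ δ ρ w →
    markedCycleType m w ≋ cycles (proj₁ ρ) → coeff c κ δ ρ ≡ (K κ ⋆ K δ) w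
  coeff≡product {m} {n} c κ δ ρ w w-type = sym (trans (expansion c κ δ w)
    (∑-unique (shapeSetoid m n) {x = ρ} {f = λ σ → coeff c κ δ σ ℤ.* K σ w}
      (shapes-unique m n) (shapes-enumeration m n ρ)
      (λ {σ} → same σ) (λ {σ} → other σ)))
    where
    same : ∀ σ → ρ ≈ˢ σ → coeff c κ δ σ ℤ.* K σ w ≡ coeff c κ δ ρ
    same σ ρ≈σ with _≋?_ _≟ˡ_ (markedCycleType m w) (cycles (proj₁ σ))
    ... | yes _   = trans (ℤ.*-identityʳ _) (coeff-cong c {κ} {κ} {δ} {δ} {σ} {ρ} ≋.↭-refl ≋.↭-refl (≋.↭-sym ρ≈σ))
    ... | no ¬w≋σ = contradiction (≋.↭-trans w-type ρ≈σ) ¬w≋σ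

    other : ∀ σ → ¬ ρ ≈ˢ σ → coeff c κ δ σ ℤ.* K σ w ≡ 0ℤ
    other σ ρ≉σ with _≋?_ _≟ˡ_ (markedCycleType m w) (cycles (proj₁ σ))
    ... | yes w≋σ = contradiction (≋.↭-trans (≋.↭-sym w-type) w≋σ) ρ≉σ
    ... | no _    = ℤ.*-zeroʳ (coeff c κ δ σ)

  -- Rounding in the degree bound

  2*d<N⇒d<⌈N/2⌉ : ∀ N d → d + d < N → d < ⌈ N /2⌉
  2*d<N⇒d<⌈N/2⌉ (suc zero)    zero    _ = s≤s z≤n
  2*d<N⇒d<⌈N/2⌉ (suc (suc N)) zero    _ = s≤s z≤n
  2*d<N⇒d<⌈N/2⌉ (suc zero)    (suc d) (s≤s ())
  2*d<N⇒d<⌈N/2⌉ (suc (suc N)) (suc d) (s≤s (s≤s h)) =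
    s≤s (2*d<N⇒d<⌈N/2⌉ N d (subst (_≤ N) (ℕ.+-suc d d) h))

  d<⌈N/2⌉⇒2*d<N : ∀ N d → d < ⌈ N /2⌉ → d + d < N
  d<⌈N/2⌉⇒2*d<N (suc zero)    zero    _         = s≤s z≤n
  d<⌈N/2⌉⇒2*d<N (suc zero)    (suc d) (s≤s ())
  d<⌈N/2⌉⇒2*d<N (suc (suc N)) zero    _         = s≤s z≤n
  d<⌈N/2⌉⇒2*d<N (suc (suc N)) (suc d) (s≤s h)   =
    s≤s (s≤s (subst (_≤ N) (sym (ℕ.+-suc d d)) (d<⌈N/2⌉⇒2*d<N N d h)))

  -- The inequality r + 2d ≤ s is 2d < s + 1 - r, which explains the added one and the rounding up.
  -- If r exceeds s, the truncated difference is 0 and there is no such d.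
  d<⌈[1+s∸r]/2⌉⇒r+2*d≤s : ∀ {d} s r → d < ⌈ suc s ∸ r /2⌉ → r + (d + d) ≤ s
  d<⌈[1+s∸r]/2⌉⇒r+2*d≤s {d} s r h with r ℕ.≤? suc s
  ... | yes r≤1+s = ℕ.s≤s⁻¹ (subst (_≤ suc s) (cong suc (ℕ.+-comm (d + d) r))
                      (ℕ.m≤o∸n⇒m+n≤o (suc (d + d)) r≤1+s (d<⌈N/2⌉⇒2*d<N (suc s ∸ r) d h)))
  ... | no  r≰1+s = contradiction (subst (λ N → d < ⌈ N /2⌉) (ℕ.m≤n⇒m∸n≡0 (ℕ.<⇒≤ (ℕ.≰⇒> r≰1+s))) h) λ ()

  ⌈[1+s∸r]/2⌉≤d⇒s<r+2*d : ∀ {d} s r → ⌈ suc s ∸ r /2⌉ ≤ d → s < r + (d + d)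
  ⌈[1+s∸r]/2⌉≤d⇒s<r+2*d {d} s r h = ℕ.≰⇒> λ r+2d≤s → ℕ.<⇒≱ (2*d<N⇒d<⌈N/2⌉ (suc s ∸ r) d
    (ℕ.m+n≤o⇒m≤o∸n (suc (d + d)) (s≤s (subst (_≤ s) (ℕ.+-comm r (d + d)) r+2d≤s)))) h

  fromℕ-≤-half : ∀ d a b r → r + (d + d) ≤ a + b → fromℕ d ℚ.≤ (ℤ.+ a ℤ.+ ℤ.+ b ℤ.- ℤ.+ r) / 2
  fromℕ-≤-half d a b r h = ℚ.toℚᵘ-cancel-≤ (begin
    ℚ.toℚᵘ (fromℕ d)  ≃⟨ toℚᵘ-fromℕ d ⟩
    mkℚᵘ (ℤ.+ d) 0    ≤⟨ *≤* doubled ⟩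
    mkℚᵘ x 1          ≃⟨ ℚ.toℚᵘ-fromℚᵘ (mkℚᵘ x 1) ⟨
    ℚ.toℚᵘ (x / 2)    ∎)
    where
    open ℚᵘ.≤-Reasoning
    x = ℤ.+ a ℤ.+ ℤ.+ b ℤ.- ℤ.+ r
    doubled : ℤ.+ d ℤ.* ℤ.+ 2 ℤ.≤ x ℤ.* ℤ.+ 1
    doubled = subst₂ ℤ._≤_
      (solve 2 (λ r d → (r :+ (d :+ d)) :- r := d :* con (ℤ.+ 2)) refl (ℤ.+ r) (ℤ.+ d))
      (sym (ℤ.*-identityʳ x)) (ℤ.+-monoˡ-≤ (ℤ.- ℤ.+ r) (ℤ.+≤+ h))
      where open ℤSolver

  -- The convolution of the two indicator functions at the target counts its factorisations. Every
  -- index in `Fin n` is below n, so the requirement to move the points from n onwards costs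
  -- nothing.
  coefficient≡factors : ∀ {m n} (κ δ ρ : Shape m) (w : Permutation′ ∣ ρ ∣) →
    (w-type : markedCycleType m w ≋ cycles ρ) (c : StructureCoefficients m n)
    (κ≤n : ∣ κ ∣ ≤ n) (δ≤n : ∣ δ ∣ ≤ n) (ρ≤n : ∣ ρ ∣ ≤ n) →
    coeff c (pad κ n κ≤n) (pad δ n δ≤n) (pad ρ n ρ≤n)
    ≡ ℤ.+ factors κ δ ρ w n n ρ≤n
  coefficient≡factors {m} {n} κ δ ρ w w-type c κ≤n δ≤n ρ≤n = begin
    coeff c (pad κ n κ≤n) (pad δ n δ≤n) (pad ρ n ρ≤n)
      ≡⟨ coeff≡product c (pad κ n κ≤n) (pad δ n δ≤n) (pad ρ n ρ≤n) π
           (proj₂ (extension-hasType ρ w w-type n (ℕ.≤⇒≤′ ρ≤n))) ⟩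
    (K (pad κ n κ≤n) ⋆ K (pad δ n δ≤n)) π
      ≡⟨ ∑-indicator P? Q? (permutations n) ⟩
    ℤ.+ count (λ u → P? u ×-dec Q? u)
      ≡⟨ cong ℤ.+_ (count-cong (λ u → P? u ×-dec Q? u) (factor? κ δ ρ w π n)
           (λ u (κu , δv) → (κ≤n , κu) , (δ≤n , δv) , λ i n≤i → contradiction n≤i (ℕ.<⇒≱ (Fin.toℕ<n i)))
           (λ u ((_ , κu) , (_ , δv) , _) → κu , δv)) ⟩
    ℤ.+ factors κ δ ρ w n n ρ≤n ∎
    where
    open ≡-Reasoning
    π = target κ δ ρ w n ρ≤n

    P? : Decidable (λ u → markedCycleType m u ≋ cycles (proj₁ (pad κ n κ≤n)))
    P? u = _≋?_ _≟ˡ_ (markedCycleType m u) _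

    Q? : Decidable (λ u → markedCycleType m (Perm.flip u · π) ≋ cycles (proj₁ (pad δ n δ≤n)))
    Q? u = _≋?_ _≟ˡ_ (markedCycleType m (Perm.flip u · π)) _

open import Data.Integer.Base using (+_; _+_; _-_)

corollary0p13 : (m : ℕ) (κ δ ρ : Shape m) → Proper κ → Proper δ → Proper ρ →
    (c : (n : ℕ) → StructureCoefficients m n) →
    ∃ λ (p : Polynomial) →
    ((n : ℕ) (hκ : ∣ κ ∣ ≤ n) (hδ : ∣ δ ∣ ≤ n) (hρ : ∣ ρ ∣ ≤ n) →
    coeff (c n) (pad κ n hκ) (pad δ n hδ) (pad ρ n hρ) / 1 ≡ eval p (fromℕ n)) ×
    (Maybe.map fromℕ (deg p) ≤₋ [ (+ ∣ κ ∣ + + ∣ δ ∣ - + ∣ ρ ∣) / 2 ])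
corollary0p13 m κ δ ρ κ-proper δ-proper ρ-proper c =
  p
  , (λ n κ≤n δ≤n ρ≤n → trans
      (cong (_/ 1) (coefficient≡factors κ δ ρ w w-type (c n) κ≤n δ≤n ρ≤n))
      (proj₂ (proj₂ polynomial) n ρ≤n))
  , degree-≤ (deg p) (λ deg≡k → ℕ.<-≤-trans (deg<length p deg≡k) (proj₁ (proj₂ polynomial)))
  where
  w = proj₁ (realize ρ)
  w-type = proj₂ (realize ρ)
  s = ∣ κ ∣ ℕ.+ ∣ δ ∣
  -- The number of e ≥ 0 with |ρ| + 2e ≤ |κ| + |δ|; it is 0 when |ρ| > |κ| + |δ|.
  L = ⌈ suc s ℕ.∸ ∣ ρ ∣ /2⌉

  polynomial : ∃ λ p → length p ≤ L ×
    (∀ n ρ≤n → fromℕ (factors κ δ ρ w n n ρ≤n) ≡ eval p (fromℕ n))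
  polynomial = factors-isPolynomial κ δ ρ w κ-proper δ-proper ρ-proper w-type L
    (λ e → ⌈[1+s∸r]/2⌉≤d⇒s<r+2*d s ∣ ρ ∣)

  p = proj₁ polynomial

  degree-≤ : ∀ d → (∀ {k} → d ≡ just k → k < L) →
    Maybe.map fromℕ d ≤₋ [ (+ ∣ κ ∣ + + ∣ δ ∣ - + ∣ ρ ∣) / 2 ]
  -- If |ρ| > |κ| + |δ|, then `L` is 0 and this is the only possible case: the bound is negative and
  -- the polynomial is zero.
  degree-≤ nothing  _   = ≤₋.⊥₋≤ _
  degree-≤ (just d) d<L = ≤₋.[ fromℕ-≤-half d (∣ κ ∣) (∣ δ ∣) (∣ ρ ∣) (d<⌈[1+s∸r]/2⌉⇒r+2*d≤s s ∣ ρ ∣ (d<L refl)) ]
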